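{- The Minimum Liar's VE-Domination Problem can be approximated within a factor of $3(p-1)$ in $p$-claw free graphs; that is, there is a polynomial-time algorithm which, given a $p$-claw free graph $G$, outputs a liar's ve-dominating set of $G$ whose cardinality is at most $3(p-1)$ times the minimum cardinality of a liar's ve-dominating set of $G$.
   Context: Graphs are finite, simple and undirected. For a graph $G=(V,E)$ and $v\in V$, $N_G(v)=\{u\in V : uv\in E\}$ and $N_G[v]=N_G(v)\cup\{v\}$. For an edge $e=xy\in E$, $N_G[e]=N_G[x]\cup N_G[y]$. A set $L\subseteq V$ is a liar's ve-dominating (vertex-edge dominating) set of $G$ if (i) for every $e\in E$, $|N_G[e]\cap L|\ge 2$, and (ii) for every pair of distinct edges $e,e'\in E$, $|(N_G[e]\cup N_G[e'])\cap L|\ge 3$. Minimum Liar's VE-Domination Problem: given a graph $G$, output a liar's ve-dominating set of $G$ of minimum cardinality. A graph is $p$-claw free if it does not have $K_{1,p}$ as an induced subgraph. -}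

module Defs where

open import Data.Bool.Base using (Bool; true; false; T)
open import Data.Fin.Base using (Fin; zero; suc)
open import Data.Fin.Subset using (Subset; ⁅_⁆; _∪_; _∩_; ∣_∣)
open import Data.Nat.Base using (ℕ; zero; suc; _+_; _≤_)
open import Data.Product.Base using (_×_; ∃-syntax)
open import Data.Sum.Base using (_⊎_)
open import Data.Vec.Base using (Vec; []; _∷_; lookup; replicate; tabulate; _[_]≔_)
open import Function.Definitions using (Injective)
open import Relation.Binary.PropositionalEquality using (_≡_; _≢_; refl)
open import Relation.Nullary.Negation.Core using (¬_)

------------------------------------------------------------------------
-- Graphs

record Graph (n : ℕ) : Set where
  field
    adj     : Fin n → Fin n → Bool
    adj-sym : ∀ u v → adj u v ≡ adj v u
    no-loop : ∀ v → adj v v ≡ false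

open Graph public

-- Each edge occurs with both orders of its endpoints; SameEdge identifies
-- the two.
record Edge {n : ℕ} (G : Graph n) : Set where
  constructor edge
  field
    src tgt  : Fin n
    adjacent : T (adj G src tgt)

open Edge public

SameEdge : ∀ {n} {G : Graph n} → Edge G → Edge G → Set
SameEdge e f = (src e ≡ src f × tgt e ≡ tgt f) ⊎ (src e ≡ tgt f × tgt e ≡ src f)

N⟨_⟩ : ∀ {n} → Graph n → Fin n → Subset n
N⟨ G ⟩ v = tabulate (adj G v)

N[_] : ∀ {n} → Graph n → Fin n → Subset n
N[ G ] v = N⟨ G ⟩ v ∪ ⁅ v ⁆

Nᵉ[_] : ∀ {n} (G : Graph n) → Edge G → Subset n
Nᵉ[ G ] e = N[ G ] (src e) ∪ N[ G ] (tgt e)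

IsLiarVEDominating : ∀ {n} → Graph n → Subset n → Set
IsLiarVEDominating G L =
    (∀ (e : Edge G) → 2 ≤ ∣ Nᵉ[ G ] e ∩ L ∣)
  × (∀ (e f : Edge G) → ¬ SameEdge e f → 3 ≤ ∣ (Nᵉ[ G ] e ∪ Nᵉ[ G ] f) ∩ L ∣)

IsMinimumLiarVEDominating : ∀ {n} → Graph n → Subset n → Set
IsMinimumLiarVEDominating G M =
    IsLiarVEDominating G M
  × (∀ L → IsLiarVEDominating G L → ∣ M ∣ ≤ ∣ L ∣)

-- The claw K₁,ₚ, with centre zero.
claw : (p : ℕ) → Graph (suc p)
claw p = record { adj = a ; adj-sym = s ; no-loop = l }
  where
  a : Fin (suc p) → Fin (suc p) → Bool
  a zero    zero    = false
  a zero    (suc _) = true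
  a (suc _) zero    = true
  a (suc _) (suc _) = false

  s : ∀ u v → a u v ≡ a v u
  s zero    zero    = refl
  s zero    (suc _) = refl
  s (suc _) zero    = refl
  s (suc _) (suc _) = refl

  l : ∀ v → a v v ≡ false
  l zero    = refl
  l (suc _) = refl

HasInduced : ∀ {m n} → Graph m → Graph n → Set
HasInduced {m} {n} H G =
  ∃[ f ] Injective _≡_ _≡_ f × (∀ (i j : Fin m) → adj G (f i) (f j) ≡ adj H i j)

ClawFree : ∀ {n} → ℕ → Graph n → Set
ClawFree p G = ¬ HasInduced (claw p) G

------------------------------------------------------------------------
-- Algorithms
--
-- The machine model is the language WHILE of N. D. Jones, "Computability
-- and Complexity from a Programming Perspective" (1997): imperative
-- programs over binary trees, where nil is false and every other tree is
-- true.  There is no equality test on trees, so each step takes constant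
-- time on a pointer machine (cons shares its arguments), and the functions
-- computable in polynomial time are the same as for Turing machines.

data Tree : Set where
  nil  : Tree
  cons : Tree → Tree → Tree

size : Tree → ℕ
size nil        = 1
size (cons a b) = suc (size a + size b)

head tail : Tree → Tree
head nil        = nil
head (cons a _) = a
tail nil        = nil
tail (cons _ b) = b

Store : ℕ → Set
Store k = Vec Tree k

data Expr (k : ℕ) : Set where
  var  : Fin k → Expr k
  nil  : Expr k
  cons : Expr k → Expr k → Expr k
  hd   : Expr k → Expr k
  tl   : Expr k → Expr k

eval : ∀ {k} → Expr k → Store k → Tree
eval (var x)    σ = lookup σ x
eval nil        σ = nil
eval (cons a b) σ = cons (eval a σ) (eval b σ)
eval (hd e)     σ = head (eval e σ)
eval (tl e)     σ = tail (eval e σ)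

-- The number of operations performed by eval.
time : ∀ {k} → Expr k → ℕ
time (var _)    = 1
time nil        = 1
time (cons a b) = suc (time a + time b)
time (hd e)     = suc (time e)
time (tl e)     = suc (time e)

infix  6 _:=_
infixr 5 _⨾_

data Cmd (k : ℕ) : Set where
  _:=_          : Fin k → Expr k → Cmd k
  _⨾_           : Cmd k → Cmd k → Cmd k
  if_then_else_ : Expr k → Cmd k → Cmd k → Cmd k
  while_loop_   : Expr k → Cmd k → Cmd k

infix 4 ⟨_,_⟩⇓_after_

-- ⟨ c , σ ⟩⇓ τ after t : started in store σ, the command c terminates in
-- store τ after exactly t steps.
data ⟨_,_⟩⇓_after_ {k : ℕ} : Cmd k → Store k → Store k → ℕ → Set where
  assign  : ∀ {x e σ} →
            ⟨ x := e , σ ⟩⇓ σ [ x ]≔ eval e σ after suc (time e)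
  seq     : ∀ {c d σ τ υ s t} →
            ⟨ c , σ ⟩⇓ τ after s → ⟨ d , τ ⟩⇓ υ after t →
            ⟨ c ⨾ d , σ ⟩⇓ υ after suc (s + t)
  ifTrue  : ∀ {e c d σ τ t} → eval e σ ≢ nil →
            ⟨ c , σ ⟩⇓ τ after t →
            ⟨ if e then c else d , σ ⟩⇓ τ after suc (time e + t)
  ifFalse : ∀ {e c d σ τ t} → eval e σ ≡ nil →
            ⟨ d , σ ⟩⇓ τ after t →
            ⟨ if e then c else d , σ ⟩⇓ τ after suc (time e + t)
  again   : ∀ {e c σ τ υ s t} → eval e σ ≢ nil →
            ⟨ c , σ ⟩⇓ τ after s → ⟨ while e loop c , τ ⟩⇓ υ after t →
            ⟨ while e loop c , σ ⟩⇓ υ after suc (time e + (s + t))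
  done    : ∀ {e c σ} → eval e σ ≡ nil →
            ⟨ while e loop c , σ ⟩⇓ σ after suc (time e)

-- Variable zero holds the input at the start and the output at the end;
-- all other variables start as nil.
record Program : Set where
  constructor program
  field
    extraVars : ℕ
    body      : Cmd (suc extraVars)

open Program public

Outputs : Program → Tree → Tree → ℕ → Set
Outputs P input output t =
  ∃[ τ ] ⟨ body P , input ∷ replicate (extraVars P) nil ⟩⇓ τ after t
       × lookup τ zero ≡ output

encodeBool : Bool → Tree
encodeBool false = nil
encodeBool true  = cons nil nil

encodeVec : ∀ {A : Set} {n} → (A → Tree) → Vec A n → Tree
encodeVec f []       = nil
encodeVec f (x ∷ xs) = cons (f x) (encodeVec f xs)

encodeSubset : ∀ {n} → Subset n → Tree
encodeSubset = encodeVec encodeBool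

-- The adjacency matrix, row by row.
encodeGraph : ∀ {n} → Graph n → Tree
encodeGraph G = encodeVec encodeSubset (tabulate N⟨ G ⟩)

{-# OPTIONS --safe #-}

-- Write h(v) for the sum of weights X over the closed neighbourhood N[v].  A
-- liar's ve-dominating set M satisfies |N[x] ∩ M| + |N[y] ∩ M| ≥ 2 for every edge
-- xy, so it is a feasible solution of the linear program that asks for
-- h(x) + h(y) ≥ 2T on edges.  A perceptron solves this program almost optimally:
-- while some edge has h(x), h(y) < T, raise X on N[x] and on N[y]; otherwise record
-- X if it is the lightest so far and lower it by one on its support.  With
-- d slightly larger than T, the squared distance from X to d·M drops in each round
-- until a weighting of total at most d|M| + n has been recorded.  Then
-- C = {v | h(v) ≥ T} is a vertex cover, and every Q ⊆ C that has at most p − 1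
-- elements in each N[m] satisfies |Q| ≤ (p − 1)|M|, by double counting.
--
-- On C (without isolated vertices) one builds a set L in three layers, the k-th of
-- which brings |N[v] ∩ L| up to k for each v ∈ C, or puts all of N[v] into L.  A
-- vertex v that still lacks a neighbour is charged for one new element of N[v]: v
-- itself if possible, otherwise a neighbour that also serves the elements of
-- N[v] ∩ L, otherwise any neighbour.  The vertices charged in one layer form an
-- independent set up to isolated pairs without common neighbours, so in a p-claw
-- free graph at most p − 1 of them lie in any N[m], and |L| ≤ 3(p − 1)|M|.  After
-- three layers, L is a liar's ve-dominating set because C is a vertex cover.
module Submission where

open import Defs
open import Data.Fin.Subset using (Subset; ∣_∣)
open import Data.Nat.Base using (ℕ; _*_; _∸_; _^_; _≤_)
open import Data.Product.Base using (_×_; ∃-syntax)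

open import Data.Bool.Base using (Bool; true; false; T) renaming (if_then_else_ to ifᵇ_then_else_)
import Data.Bool.Properties as Bool
open import Data.Empty using (⊥; ⊥-elim)
open import Data.Fin.Base using (Fin; zero; suc; toℕ; inject₁; inject≤; fromℕ)
open import Data.Fin.Properties using (toℕ-inject₁; toℕ-fromℕ; toℕ<n; any?; inject≤-injective)
  renaming (_≟_ to _≟ᶠ_; suc-injective to sucᶠ-injective)
open import Data.Fin.Subset using (⁅_⁆; _∪_; _∩_) renaming (_∈_ to _∈ˢ_)
open import Data.Fin.Subset.Properties using (x∈p∪q⁺; x∈p∪q⁻; x∈p∩q⁺; x∈p∩q⁻; x∈⁅x⁆; x∈⁅y⁆⇒x≡y)
open import Data.Integer.Base as ℤ using (ℤ; +_; -[1+_])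
import Data.Integer.Properties as ℤ
import Data.Integer.Tactic.RingSolver as ℤ-Solver
open import Data.List.Base using (List; []; _∷_)
open import Data.List.Relation.Unary.All using (All; []; _∷_)
open import Data.Nat.Base
  using (zero; suc; _+_; _≤ᵇ_; _<_; z≤n; s≤s; s≤s⁻¹; >-nonZero)
open import Data.Nat.Properties
import Data.Nat.Tactic.RingSolver as ℕ-Solver
open import Data.Product.Base using (_,_; proj₁; proj₂)
open import Data.Sum.Base as Sum using (_⊎_; inj₁; inj₂; [_,_]′; swap)
open import Data.Unit.Base using (⊤; tt)
open import Data.Vec.Base using ([]; _∷_; lookup; tabulate; _[_]≔_)
open import Data.Vec.Properties using (tabulate-cong; lookup⇒[]=; []=⇒lookup; lookup∘tabulate)
open import Function.Base using (id; _∘_)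
open import Function.Bundles using (Equivalence)
open import Function.Definitions using (Injective)
open import Relation.Binary.PropositionalEquality
open import Relation.Nullary.Decidable.Core using (Dec; yes; no; _×-dec_; ¬?)
open import Relation.Nullary.Negation.Core using (¬_; contradiction)

-- Terms and their compilation to WHILE

infixr 6 _⊗_

data Ty : Set where
  bool fin num : Ty
  vec          : Ty → Ty
  _⊗_          : Ty → Ty → Ty

-- All vectors have the same length `n` and all indices lie below it, so a single number bounds
-- every loop.
⟦_⟧ : Ty → ℕ → Set
⟦ bool ⟧  n = Bool
⟦ fin ⟧   n = Fin n
⟦ num ⟧   n = ℤ
⟦ vec τ ⟧ n = Fin n → ⟦ τ ⟧ n
⟦ σ ⊗ τ ⟧ n = ⟦ σ ⟧ n × ⟦ τ ⟧ n

unary : ℕ → Tree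
unary zero    = nil
unary (suc m) = cons nil (unary m)

-- Positive and negative numbers are told apart by the label of their cells,
-- so that inc and dec are a cons or a tl.
encodeℤ : ℤ → Tree
encodeℤ (+ m)          = unary m
encodeℤ -[1+ zero ]    = cons (cons nil nil) nil
encodeℤ -[1+ (suc m) ] = cons (cons nil nil) (encodeℤ -[1+ m ])

encode : ∀ τ {n} → ⟦ τ ⟧ n → Tree
encode bool    b       = encodeBool b
encode fin     i       = unary (toℕ i)
encode num     z       = encodeℤ z
encode (vec τ) f       = encodeVec id (tabulate (encode τ ∘ f))
encode (σ ⊗ τ) (a , b) = cons (encode σ a) (encode τ b)

Cxt : Set
Cxt = List Ty

⟦_⟧ᶜ : Cxt → ℕ → Set
⟦ [] ⟧ᶜ    n = ⊤
⟦ τ ∷ Γ ⟧ᶜ n = ⟦ τ ⟧ n × ⟦ Γ ⟧ᶜ n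

-- An environment ends in the number n, which the loops count down from.
encodeᶜ : ∀ Γ {n} → ⟦ Γ ⟧ᶜ n → Tree
encodeᶜ []      {n} _       = unary n
encodeᶜ (τ ∷ Γ)     (a , ρ) = cons (encode τ a) (encodeᶜ Γ ρ)

infix 4 _∋_

data _∋_ : Cxt → Ty → Set where
  here  : ∀ {Γ τ} → τ ∷ Γ ∋ τ
  there : ∀ {Γ σ τ} → Γ ∋ τ → σ ∷ Γ ∋ τ

fetch : ∀ {Γ τ n} → Γ ∋ τ → ⟦ Γ ⟧ᶜ n → ⟦ τ ⟧ n
fetch here      (a , _) = a
fetch (there i) (_ , ρ) = fetch i ρ

fetchAll : ∀ {Γ Δ n} → All (Γ ∋_) Δ → ⟦ Γ ⟧ᶜ n → ⟦ Δ ⟧ᶜ n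
fetchAll []       ρ = tt
fetchAll (i ∷ is) ρ = fetch i ρ , fetchAll is ρ

data Op : Ty → Ty → Set where
  fst   : ∀ {σ τ} → Op (σ ⊗ τ) σ
  snd   : ∀ {σ τ} → Op (σ ⊗ τ) τ
  inc   : Op num num
  dec   : Op num num
  pos   : Op num bool
  index : ∀ {τ} → Op (vec τ ⊗ fin) τ
  monus : Op (fin ⊗ fin) num

-- Loops and tabulations make exactly `n` rounds and there is no other recursion, so every term runs
-- in time polynomial in `n`. `call` replaces the environment by a selection of its entries, which
-- lets a term be written once for a context of its own.
data Term (Γ : Cxt) : Ty → Set where
  var  : ∀ {τ} → Γ ∋ τ → Term Γ τ
  bit  : Bool → Term Γ bool
  zero : Term Γ num
  app  : ∀ {σ τ} → Op σ τ → Term Γ σ → Term Γ τ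
  pair : ∀ {σ τ} → Term Γ σ → Term Γ τ → Term Γ (σ ⊗ τ)
  cond : ∀ {τ} → Term Γ bool → Term Γ τ → Term Γ τ → Term Γ τ
  bind : ∀ {σ τ} → Term Γ σ → Term (σ ∷ Γ) τ → Term Γ τ
  call : ∀ {Δ τ} → All (Γ ∋_) Δ → Term Δ τ → Term Γ τ
  loop : ∀ {τ} → Term Γ τ → Term (fin ∷ τ ∷ Γ) τ → Term Γ τ
  tab  : ∀ {τ} → Term (fin ∷ Γ) τ → Term Γ (vec τ)

-- Indices are processed from the largest down to `zero`, as in a machine loop with a falling unary
-- counter.
for : ∀ {A : Set} {n} → (Fin n → A → A) → A → A
for {n = zero}  f a = a
for {n = suc n} f a = f zero (for (f ∘ suc) a)

isPositive : ℤ → Bool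
isPositive (+ suc _) = true
isPositive _         = false

⟦_⟧ᵒ : ∀ {σ τ n} → Op σ τ → ⟦ σ ⟧ n → ⟦ τ ⟧ n
⟦ fst ⟧ᵒ   (a , _) = a
⟦ snd ⟧ᵒ   (_ , b) = b
⟦ inc ⟧ᵒ   z       = ℤ.suc z
⟦ dec ⟧ᵒ   z       = ℤ.pred z
⟦ pos ⟧ᵒ   z       = isPositive z
⟦ index ⟧ᵒ (f , i) = f i
⟦ monus ⟧ᵒ (i , j) = + (toℕ i ∸ toℕ j)

⟦_⟧ᵗ : ∀ {Γ τ n} → Term Γ τ → ⟦ Γ ⟧ᶜ n → ⟦ τ ⟧ n
⟦ var i ⟧ᵗ      ρ = fetch i ρ
⟦ bit b ⟧ᵗ      ρ = b
⟦ zero ⟧ᵗ       ρ = + 0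
⟦ app o t ⟧ᵗ    ρ = ⟦ o ⟧ᵒ (⟦ t ⟧ᵗ ρ)
⟦ pair t u ⟧ᵗ   ρ = ⟦ t ⟧ᵗ ρ , ⟦ u ⟧ᵗ ρ
⟦ cond b t u ⟧ᵗ ρ = ifᵇ ⟦ b ⟧ᵗ ρ then ⟦ t ⟧ᵗ ρ else ⟦ u ⟧ᵗ ρ
⟦ bind t u ⟧ᵗ   ρ = ⟦ u ⟧ᵗ (⟦ t ⟧ᵗ ρ , ρ)
⟦ call is t ⟧ᵗ  ρ = ⟦ t ⟧ᵗ (fetchAll is ρ)
⟦ loop t u ⟧ᵗ   ρ = for (λ i a → ⟦ u ⟧ᵗ (i , a , ρ)) (⟦ t ⟧ᵗ ρ)
⟦ tab t ⟧ᵗ      ρ = λ i → ⟦ t ⟧ᵗ (i , ρ)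

-- Compiled terms use two variables: x holds the environment before the run
-- and the value after it, s a stack that is left as it was.
x s : Expr 2
x = var zero
s = var (suc zero)

infix 25 x≔_ s≔_

x≔_ s≔_ : Expr 2 → Cmd 2
x≔ e = zero := e
s≔ e = suc zero := e

get : ∀ {Γ τ} → Γ ∋ τ → Expr 2 → Expr 2
get here      e = hd e
get (there i) e = get i (tl e)

ruler : Cxt → Expr 2 → Expr 2
ruler []      e = e
ruler (_ ∷ Γ) e = ruler Γ (tl e)

gather : ∀ {Γ Δ} → All (Γ ∋_) Δ → Expr 2
gather {Γ} []       = ruler Γ x
gather     (i ∷ is) = cons (get i x) (gather is)

one : ∀ {k} → Expr k
one = cons nil nil

-- x = cons a (unary m)  becomes  x = tlᵐ a
drop : Cmd 2
drop = while tl x loop x≔ cons (tl (hd x)) (tl (tl x)) ⨾ x≔ hd x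

opCmd : ∀ {σ τ} → Op σ τ → Cmd 2
opCmd fst   = x≔ hd x
opCmd snd   = x≔ tl x
opCmd inc   = if hd x then x≔ tl x else x≔ cons nil x
opCmd dec   = if x then (if hd x then x≔ cons one x else x≔ tl x) else x≔ cons one nil
opCmd pos   = if x then (if hd x then x≔ nil else x≔ one) else x≔ nil
opCmd index = drop ⨾ x≔ hd x
opCmd monus = drop

-- The counter on top of the stack is the index of the current round.
rounds : Cmd 2 → Cmd 2
rounds c =
  while hd s loop (s≔ cons (tl (hd s)) (tl s) ⨾ x≔ cons (hd s) (cons x (hd (tl s))) ⨾ c)
  ⨾ s≔ tl (tl s)

compile : ∀ {Γ τ} → Term Γ τ → Cmd 2
compile (var i)      = x≔ get i x
compile (bit false)  = x≔ nil
compile (bit true)   = x≔ one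
compile zero         = x≔ nil
compile (app o t)    = compile t ⨾ opCmd o
compile (pair t u)   = s≔ cons x s ⨾ compile t ⨾ s≔ cons x s ⨾ x≔ hd (tl s) ⨾ compile u
                       ⨾ x≔ cons (hd s) x ⨾ s≔ tl (tl s)
compile (cond b t u) = s≔ cons x s ⨾ compile b ⨾ s≔ cons x s ⨾ x≔ hd (tl s)
                       ⨾ if hd s then (s≔ tl (tl s) ⨾ compile t) else (s≔ tl (tl s) ⨾ compile u)
compile (bind t u)   = s≔ cons x s ⨾ compile t ⨾ x≔ cons x (hd s) ⨾ s≔ tl s ⨾ compile u
compile (call is t)  = x≔ gather is ⨾ compile t
compile {Γ} (loop t u) =
  s≔ cons x s ⨾ compile t ⨾ s≔ cons (ruler Γ (hd s)) s ⨾ rounds (compile u)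
compile {Γ} (tab t)    =
  s≔ cons x s ⨾ x≔ nil ⨾ s≔ cons (ruler Γ (hd s)) s
  ⨾ rounds (s≔ cons (hd (tl x)) s ⨾ x≔ cons (hd x) (tl (tl x)) ⨾ compile t
            ⨾ x≔ cons x (hd s) ⨾ s≔ tl s)

-- Correctness and running time of compiled terms

Runs : Cmd 2 → Store 2 → Store 2 → ℕ → Set
Runs c σ τ b = ∃[ t ] ⟨ c , σ ⟩⇓ τ after t × t ≤ b

infixr 5 _»_ _▸_

-- Follows the rule `seq`, so that a bound has the same shape as its command.
_»_ : ℕ → ℕ → ℕ
a » b = suc (a + b)

_▸_ : ∀ {c d σ τ υ a b} → Runs c σ τ a → Runs d τ υ b → Runs (c ⨾ d) σ υ (a » b)
(_ , p , p≤) ▸ (_ , q , q≤) = _ , seq p q , s≤s (+-mono-≤ p≤ q≤)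

set : ∀ {y e σ} → Runs (y := e) σ (σ [ y ]≔ eval e σ) (suc (time e))
set = _ , assign , ≤-refl

setx : ∀ {e a r v} → eval e (a ∷ r ∷ []) ≡ v → Runs (x≔ e) (a ∷ r ∷ []) (v ∷ r ∷ []) (suc (time e))
setx refl = set

sets : ∀ {e a r v} → eval e (a ∷ r ∷ []) ≡ v → Runs (s≔ e) (a ∷ r ∷ []) (a ∷ v ∷ []) (suc (time e))
sets refl = set

weaken : ∀ {c σ τ a b} → a ≤ b → Runs c σ τ a → Runs c σ τ b
weaken a≤b (_ , p , p≤) = _ , p , ≤-trans p≤ a≤b

ifTrueRuns : ∀ {e c d σ τ a} b → eval e σ ≢ nil → Runs c σ τ a →
             Runs (if e then c else d) σ τ (time e » (a + b))
ifTrueRuns {e} b e≢ (_ , p , p≤) =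
  _ , ifTrue e≢ p , s≤s (+-monoʳ-≤ (time e) (≤-trans p≤ (m≤m+n _ b)))

ifFalseRuns : ∀ {e c d σ τ b} a → eval e σ ≡ nil → Runs d σ τ b →
              Runs (if e then c else d) σ τ (time e » (a + b))
ifFalseRuns {e} {b = b} a e≡ (_ , p , p≤) =
  _ , ifFalse e≡ p , s≤s (+-monoʳ-≤ (time e) (≤-trans p≤ (m≤n+m b a)))

-- `g` pays for a test of the guard and `b` for a run of the body; the leading `g` is the last test,
-- which fails.
repeated : ℕ → ℕ → ℕ → ℕ
repeated g b m = g + m * (g + b)

doneRuns : ∀ {e c σ} b → eval e σ ≡ nil → Runs (while e loop c) σ σ (repeated (suc (time e)) b 0)
doneRuns b e≡ = _ , done e≡ , ≤-reflexive (sym (+-identityʳ _))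

againRuns : ∀ {e c σ τ υ b m} → eval e σ ≢ nil → Runs c σ τ b →
            Runs (while e loop c) τ υ (repeated (suc (time e)) b m) →
            Runs (while e loop c) σ υ (repeated (suc (time e)) b (suc m))
againRuns {e} {b = b} {m} e≢ (_ , p , p≤) (_ , q , q≤) =
  _ , again e≢ p q , ≤-trans (s≤s (+-monoʳ-≤ (time e) (+-mono-≤ p≤ q≤)))
                             (≤-reflexive (rearrange (time e) b m))
  where
  rearrange : ∀ e b m → suc (e + (b + (suc e + m * (suc e + b)))) ≡ suc e + suc m * (suc e + b)
  rearrange = ℕ-Solver.solve-∀

repeated-mono : ∀ g b {m n} → m ≤ n → repeated g b m ≤ repeated g b n
repeated-mono g b m≤n = +-monoʳ-≤ g (*-monoˡ-≤ (g + b) m≤n)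

within : ∀ {c σ τ a b} → Runs c σ τ a → {T (a ≤ᵇ b)} → Runs c σ τ b
within p {a≤b} = weaken (≤ᵇ⇒≤ _ _ a≤b) p

cons≢nil : ∀ {a b : Tree} → cons a b ≢ nil
cons≢nil ()

dropTree : ℕ → Tree → Tree
dropTree zero    a = a
dropTree (suc m) a = dropTree m (tail a)

opCost : ∀ {σ τ} → Op σ τ → ℕ → ℕ
dropCost : ℕ → ℕ
dropCost n = repeated 3 8 n » 3

opCost index n = dropCost n » 3
opCost monus n = dropCost n
opCost _     n = 20

drop-runs : ∀ m a r → Runs drop (cons a (unary m) ∷ r ∷ []) (dropTree m a ∷ r ∷ []) (dropCost m)
drop-runs m a r = iterate m a ▸ set
  where
  iterate : ∀ m a → Runs (while tl x loop x≔ cons (tl (hd x)) (tl (tl x)))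
                         (cons a (unary m) ∷ r ∷ []) (cons (dropTree m a) nil ∷ r ∷ [])
                         (repeated 3 8 m)
  iterate zero    a = doneRuns 8 refl
  iterate (suc m) a = againRuns {m = m} cons≢nil set (iterate m (tail a))

drop-runs-fin : ∀ {n} (i : Fin n) a r →
                Runs drop (cons a (unary (toℕ i)) ∷ r ∷ []) (dropTree (toℕ i) a ∷ r ∷ []) (dropCost n)
drop-runs-fin i a r =
  weaken (s≤s (+-monoˡ-≤ 3 (repeated-mono 3 8 (<⇒≤ (toℕ<n i))))) (drop-runs (toℕ i) a r)

dropTree-unary : ∀ m k → dropTree m (unary k) ≡ unary (k ∸ m)
dropTree-unary zero    k       = refl
dropTree-unary (suc m) (suc k) = dropTree-unary m k
dropTree-unary (suc m) zero    = trans (dropTree-unary m 0) (cong unary (0∸n≡0 m))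

dropTree-encodeVec : ∀ {n} (f : Fin n → Tree) i →
                     head (dropTree (toℕ i) (encodeVec id (tabulate f))) ≡ f i
dropTree-encodeVec f zero    = refl
dropTree-encodeVec f (suc i) = dropTree-encodeVec (f ∘ suc) i

op-runs : ∀ {σ τ n} (o : Op σ τ) (a : ⟦ σ ⟧ n) r →
          Runs (opCmd o) (encode σ a ∷ r ∷ []) (encode τ (⟦ o ⟧ᵒ a) ∷ r ∷ []) (opCost o n)
op-runs fst (a , b) r = within set
op-runs snd (a , b) r = within set
op-runs inc (+ m) r = within (ifFalseRuns 3 (unary-head m) set)
  where
  unary-head : ∀ m → head (unary m) ≡ nil
  unary-head zero    = refl
  unary-head (suc m) = refl
op-runs inc -[1+ zero ]  r = within (ifTrueRuns 4 cons≢nil set)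
op-runs inc -[1+ suc m ] r = within (ifTrueRuns 4 cons≢nil set)
op-runs dec (+ zero)  r = within (ifFalseRuns 0 refl set)
op-runs dec (+ suc m) r = within (ifTrueRuns 6 cons≢nil (ifFalseRuns 6 refl set))
op-runs dec -[1+ zero ]  r = within (ifTrueRuns 6 cons≢nil (ifTrueRuns 3 cons≢nil set))
op-runs dec -[1+ suc m ] r = within (ifTrueRuns 6 cons≢nil (ifTrueRuns 3 cons≢nil set))
op-runs pos (+ zero)  r = within (ifFalseRuns 13 refl set)
op-runs pos (+ suc m) r = within (ifTrueRuns 8 cons≢nil (ifFalseRuns 2 refl set))
op-runs pos -[1+ zero ]  r = within (ifTrueRuns 8 cons≢nil (ifTrueRuns 4 cons≢nil set))
op-runs pos -[1+ suc m ] r = within (ifTrueRuns 8 cons≢nil (ifTrueRuns 4 cons≢nil set))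
op-runs {vec τ ⊗ fin} index (f , i) r =
  drop-runs-fin i _ r ▸ setx (dropTree-encodeVec (encode τ ∘ f) i)
op-runs {n = n} monus (i , j) r =
  subst (λ a → Runs drop (encode (fin ⊗ fin) (i , j) ∷ r ∷ []) (a ∷ r ∷ []) (dropCost n))
        (dropTree-unary (toℕ j) (toℕ i))
        (drop-runs-fin j (unary (toℕ i)) r)

get-correct : ∀ {Γ τ n} (i : Γ ∋ τ) (ρ : ⟦ Γ ⟧ᶜ n) {e σ} →
              eval e σ ≡ encodeᶜ Γ ρ → eval (get i e) σ ≡ encode τ (fetch i ρ)
get-correct here      (a , _) p = cong head p
get-correct (there i) (_ , ρ) p = get-correct i ρ (cong tail p)

ruler-correct : ∀ Γ {n} (ρ : ⟦ Γ ⟧ᶜ n) {e σ} →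
                eval e σ ≡ encodeᶜ Γ ρ → eval (ruler Γ e) σ ≡ unary n
ruler-correct []      ρ       p = p
ruler-correct (_ ∷ Γ) (_ , ρ) p = ruler-correct Γ ρ (cong tail p)

gather-correct : ∀ {Γ Δ n} (is : All (Γ ∋_) Δ) (ρ : ⟦ Γ ⟧ᶜ n) r →
                 eval (gather is) (encodeᶜ Γ ρ ∷ r ∷ []) ≡ encodeᶜ Δ (fetchAll is ρ)
gather-correct {Γ} []   ρ r = ruler-correct Γ ρ refl
gather-correct (i ∷ is) ρ r = cong₂ cons (get-correct i ρ refl) (gather-correct is ρ r)

-- The counter falls, so the round executed first is the innermost application, at the largest
-- index. This peels it off.
for-top : ∀ {A : Set} {n} (f : Fin (suc n) → A → A) a →
          for f a ≡ for (f ∘ inject₁) (f (fromℕ n) a)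
for-top {n = zero}  f a = refl
for-top {n = suc n} f a = cong (f zero) (for-top (f ∘ suc) a)

roundsCost : ℕ → ℕ → ℕ
roundsCost b n = repeated 3 (7 » 9 » b) n » 4

-- `code` is arbitrary because a tabulation accumulates the tail of an encoded vector, which is not
-- itself the encoding of a value; there `code` is `id`.
rounds-run : ∀ {A : Set} (code : A → Tree) {c E σ b n} (f : Fin n → A → A) →
             (∀ i a {q} → Runs c (cons (unary (toℕ i)) (cons (code a) E) ∷ cons q (cons E σ) ∷ [])
                                 (code (f i a) ∷ cons q (cons E σ) ∷ []) b) →
             ∀ a → Runs (rounds c) (code a ∷ cons (unary n) (cons E σ) ∷ [])
                                   (code (for f a) ∷ σ ∷ []) (roundsCost b n)
rounds-run code {c} {E} {σ} {b} f body a = iterate f body a ▸ set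
  where
  step : Cmd 2
  step = s≔ cons (tl (hd s)) (tl s) ⨾ x≔ cons (hd s) (cons x (hd (tl s))) ⨾ c

  iterate : ∀ {n} (f : Fin n → _ → _) →
            (∀ i a {q} → Runs c (cons (unary (toℕ i)) (cons (code a) E) ∷ cons q (cons E σ) ∷ [])
                                (code (f i a) ∷ cons q (cons E σ) ∷ []) b) →
            ∀ a → Runs (while hd s loop step) (code a ∷ cons (unary n) (cons E σ) ∷ [])
                       (code (for f a) ∷ cons nil (cons E σ) ∷ []) (repeated 3 (7 » 9 » b) n)
  iterate {zero}  f body a = doneRuns (7 » 9 » b) refl
  iterate {suc n} f body a rewrite for-top f a =
    againRuns {m = n} cons≢nil
      (set ▸ set ▸ subst (λ m → Runs c (cons (unary m) (cons (code a) E) ∷ cons (unary n) (cons E σ) ∷ [])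
                                       (code (f (fromℕ n) a) ∷ cons (unary n) (cons E σ) ∷ []) b)
                         (toℕ-fromℕ n) (body (fromℕ n) a))
      (iterate (f ∘ inject₁)
        (λ i a {q} → subst (λ m → Runs c (cons (unary m) (cons (code a) E) ∷ cons q (cons E σ) ∷ [])
                                         (code (f (inject₁ i) a) ∷ cons q (cons E σ) ∷ []) b)
                           (toℕ-inject₁ i) (body (inject₁ i) a))
        (f (fromℕ n) a))

-- The last index is consed first, so the vector comes out in the right order.
for-cons : ∀ {n} (f : Fin n → Tree) → for (λ i → cons (f i)) nil ≡ encodeVec id (tabulate f)
for-cons {zero}  f = refl
for-cons {suc n} f = cong (cons (f zero)) (for-cons (f ∘ suc))

-- The bound depends on `n` but not on the data; for `cond` it adds up both branches.
cost : ∀ {Γ τ} → Term Γ τ → ℕ → ℕ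
cost (var i)        n = suc (time (get i x))
cost (bit b)        n = 4
cost zero           n = 2
cost (app o t)      n = cost t n » opCost o n
cost (pair t u)     n = 4 » cost t n » 4 » 4 » cost u n » 5 » 4
cost (cond b t u)   n = 4 » cost b n » 4 » 4 » 2 » (4 » cost t n) + (4 » cost u n)
cost (bind t u)     n = 4 » cost t n » 5 » 3 » cost u n
cost (call is t)    n = suc (time (gather is)) » cost t n
cost {Γ} (loop t u) n =
  4 » cost t n » suc (time (cons (ruler Γ (hd s)) s)) » roundsCost (cost u n) n
cost {Γ} (tab t)    n =
  4 » 2 » suc (time (cons (ruler Γ (hd s)) s)) » roundsCost (6 » 7 » cost t n » 5 » 3) n

-- The stack `r` is arbitrary and restored at the end; hence the induction hypotheses apply below
-- saved environments and loop counters.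
compile-correct : ∀ {Γ τ n} (t : Term Γ τ) (ρ : ⟦ Γ ⟧ᶜ n) r →
                  Runs (compile t) (encodeᶜ Γ ρ ∷ r ∷ []) (encode τ (⟦ t ⟧ᵗ ρ) ∷ r ∷ []) (cost t n)
compile-correct (var i)      ρ r = setx (get-correct i ρ refl)
compile-correct (bit false)  ρ r = within set
compile-correct (bit true)   ρ r = set
compile-correct zero         ρ r = set
compile-correct (app o t)    ρ r = compile-correct t ρ r ▸ op-runs o (⟦ t ⟧ᵗ ρ) r
compile-correct (pair t u)   ρ r =
  set ▸ compile-correct t ρ _ ▸ set ▸ set ▸ compile-correct u ρ _ ▸ set ▸ set
compile-correct {n = n} (cond b t u) ρ r =
  set ▸ compile-correct b ρ _ ▸ set ▸ set ▸ branch (⟦ b ⟧ᵗ ρ)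
  where
  branch : ∀ v → Runs (if hd s then (s≔ tl (tl s) ⨾ compile t) else (s≔ tl (tl s) ⨾ compile u))
                      (encodeᶜ _ ρ ∷ cons (encodeBool v) (cons (encodeᶜ _ ρ) r) ∷ [])
                      (encode _ (ifᵇ v then ⟦ t ⟧ᵗ ρ else ⟦ u ⟧ᵗ ρ) ∷ r ∷ []) _
  branch true  = ifTrueRuns (4 » cost u n) cons≢nil (set ▸ compile-correct t ρ r)
  branch false = ifFalseRuns (4 » cost t n) refl (set ▸ compile-correct u ρ r)
compile-correct (bind t u)   ρ r =
  set ▸ compile-correct t ρ _ ▸ set ▸ set ▸ compile-correct u (⟦ t ⟧ᵗ ρ , ρ) r
compile-correct (call is t)  ρ r = setx (gather-correct is ρ r) ▸ compile-correct t (fetchAll is ρ) r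
compile-correct {Γ} {τ} (loop t u) ρ r =
  set ▸ compile-correct t ρ _
  ▸ sets (cong (λ a → cons a (cons (encodeᶜ Γ ρ) r)) (ruler-correct Γ ρ refl))
  ▸ rounds-run (encode τ) (λ i a → ⟦ u ⟧ᵗ (i , a , ρ)) (λ i a → compile-correct u (i , a , ρ) _) (⟦ t ⟧ᵗ ρ)
compile-correct {Γ} {vec τ} (tab t) ρ r =
  set ▸ set
  ▸ sets (cong (λ a → cons a (cons (encodeᶜ Γ ρ) r)) (ruler-correct Γ ρ refl))
  ▸ subst (λ a → Runs _ (nil ∷ _ ∷ []) (a ∷ r ∷ []) _) (for-cons (λ i → encode τ (⟦ t ⟧ᵗ (i , ρ))))
      (rounds-run id (λ i → cons (encode τ (⟦ t ⟧ᵗ (i , ρ))))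
        (λ i a → set ▸ set ▸ compile-correct t (i , ρ) _ ▸ set ▸ set) nil)

-- Polynomial bounds

PolyBounded : (ℕ → ℕ) → Set
PolyBounded f = ∃[ c ] ∃[ k ] ∀ n → f n ≤ c * suc n ^ k

const-poly : ∀ a → PolyBounded (λ _ → a)
const-poly a = a , 0 , λ n → ≤-reflexive (sym (*-identityʳ a))

-- The base `suc n` is positive, so both powers may be raised to the exponent `k + l`, which also
-- absorbs the additional step.
»-poly : ∀ {f g} → PolyBounded f → PolyBounded g → PolyBounded (λ n → f n » g n)
»-poly {f} {g} (c , k , p) (d , l , q) = suc (c + d) , k + l , λ n → begin
  suc (f n + g n)                                                 ≤⟨ s≤s (+-mono-≤ (p n) (q n)) ⟩
  1 + (c * suc n ^ k + d * suc n ^ l)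
    ≤⟨ +-mono-≤ (m^n>0 (suc n) (k + l)) (+-mono-≤ (*-monoʳ-≤ c (^-monoʳ-≤ (suc n) (m≤m+n k l)))
                                                 (*-monoʳ-≤ d (^-monoʳ-≤ (suc n) (m≤n+m l k)))) ⟩
  suc n ^ (k + l) + (c * suc n ^ (k + l) + d * suc n ^ (k + l))   ≡⟨ collect (suc n ^ (k + l)) c d ⟩
  suc (c + d) * suc n ^ (k + l)                                   ∎
  where
  open ≤-Reasoning
  collect : ∀ m c d → m + (c * m + d * m) ≡ suc (c + d) * m
  collect = ℕ-Solver.solve-∀

repeated-poly : ∀ g {f} → PolyBounded f → PolyBounded (λ n → repeated g (f n) n)
repeated-poly g {f} (c , k , p) = g + (g + c) , suc k , λ n → begin
  g + n * (g + f n)                                   ≤⟨ +-mono-≤ (bound g n (suc k)) (begin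
    n * (g + f n)                 ≤⟨ *-mono-≤ (n≤1+n n) (+-mono-≤ (bound g n k) (p n)) ⟩
    suc n * (g * suc n ^ k + c * suc n ^ k)
                                  ≡⟨ collect (suc n) g c (suc n ^ k) ⟩
    (g + c) * suc n ^ suc k       ∎) ⟩
  g * suc n ^ suc k + (g + c) * suc n ^ suc k         ≡⟨ *-distribʳ-+ (suc n ^ suc k) g (g + c) ⟨
  (g + (g + c)) * suc n ^ suc k                       ∎
  where
  open ≤-Reasoning
  bound : ∀ g n k → g ≤ g * suc n ^ k
  bound g n k = begin
    g             ≡⟨ *-identityʳ g ⟨
    g * 1         ≤⟨ *-monoʳ-≤ g (m^n>0 (suc n) k) ⟩
    g * suc n ^ k ∎
  collect : ∀ m g c q → m * (g * q + c * q) ≡ (g + c) * (m * q)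
  collect = ℕ-Solver.solve-∀

rounds-poly : ∀ {f} → PolyBounded f → PolyBounded (λ n → roundsCost (f n) n)
rounds-poly p =
  »-poly (repeated-poly 3 (»-poly (const-poly 7) (»-poly (const-poly 9) p))) (const-poly 4)

drop-poly : PolyBounded dropCost
drop-poly = »-poly (repeated-poly 3 (const-poly 8)) (const-poly 3)

op-poly : ∀ {σ τ} (o : Op σ τ) → PolyBounded (opCost o)
op-poly fst   = const-poly 20
op-poly snd   = const-poly 20
op-poly inc   = const-poly 20
op-poly dec   = const-poly 20
op-poly pos   = const-poly 20
op-poly index = »-poly drop-poly (const-poly 3)
op-poly monus = drop-poly

cost-poly : ∀ {Γ τ} (t : Term Γ τ) → PolyBounded (cost t)
cost-poly (var i)      = const-poly _
cost-poly (bit b)      = const-poly 4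
cost-poly zero         = const-poly 2
cost-poly (app o t)    = »-poly (cost-poly t) (op-poly o)
cost-poly (pair t u)   =
  »-poly (const-poly 4) (»-poly (cost-poly t) (»-poly (const-poly 4) (»-poly (const-poly 4)
    (»-poly (cost-poly u) (const-poly (5 » 4))))))
cost-poly (cond b t u) =
  »-poly (const-poly 4) (»-poly (cost-poly b) (»-poly (const-poly 4) (»-poly (const-poly 4)
    (»-poly (const-poly 2) (+-poly (»-poly (const-poly 4) (cost-poly t))
                                   (»-poly (const-poly 4) (cost-poly u)))))))
  where
  +-poly : ∀ {f g} → PolyBounded f → PolyBounded g → PolyBounded (λ n → f n + g n)
  +-poly p q with c , k , r ← »-poly p q = c , k , λ n → ≤-trans (n≤1+n _) (r n)
cost-poly (bind t u)   =
  »-poly (const-poly 4) (»-poly (cost-poly t) (»-poly (const-poly 5) (»-poly (const-poly 3) (cost-poly u))))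
cost-poly (call is t)  = »-poly (const-poly _) (cost-poly t)
cost-poly {Γ} (loop t u) =
  »-poly (const-poly 4) (»-poly (cost-poly t) (»-poly (const-poly (suc (time (cons (ruler Γ (hd s)) s)))) (rounds-poly (cost-poly u))))
cost-poly {Γ} (tab t)    =
  »-poly (const-poly 4) (»-poly (const-poly 2) (»-poly (const-poly (suc (time (cons (ruler Γ (hd s)) s))))
    (rounds-poly (»-poly (const-poly 6) (»-poly (const-poly 7) (»-poly (cost-poly t) (const-poly (5 » 3))))))))

-- From terms to programs on adjacency matrices

countRows : Cmd 2
countRows = while tl x loop (s≔ cons nil s ⨾ x≔ cons (hd x) (tl (tl x)))

-- The input does not contain `n` as a number: a copy of the matrix is consumed row by row while its
-- length is built on `s` in unary. This number then becomes the end of the environment.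
toProgram : Term (vec (vec bool) ∷ []) (vec bool) → Program
toProgram t = program 1
  (x≔ cons x x ⨾ countRows ⨾ x≔ cons (hd x) s ⨾ s≔ nil ⨾ compile t)

encodeVec-tabulate : ∀ {A : Set} {n} (f : A → Tree) (g : Fin n → A) →
                     encodeVec f (tabulate g) ≡ encodeVec id (tabulate (f ∘ g))
encodeVec-tabulate {n = zero}  f g = refl
encodeVec-tabulate {n = suc n} f g = cong (cons (f (g zero))) (encodeVec-tabulate f (g ∘ suc))

encodeGraph-matrix : ∀ {n} (G : Graph n) → encodeGraph G ≡ encode (vec (vec bool)) (adj G)
encodeGraph-matrix G =
  trans (encodeVec-tabulate encodeSubset N⟨ G ⟩)
        (cong (encodeVec id) (tabulate-cong (λ v → encodeVec-tabulate encodeBool (adj G v))))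

-- Turns a bound in `suc n` into one in the size of the input.
n<size : ∀ {n} (f : Fin n → Tree) → n < size (encodeVec id (tabulate f))
n<size {zero}  f = s≤s z≤n
n<size {suc n} f = s≤s (≤-trans (n<size (f ∘ suc)) (m≤n+m _ _))

countRows-runs : ∀ {n} (f : Fin n → Tree) a m →
                 Runs countRows (cons a (encodeVec id (tabulate f)) ∷ unary m ∷ [])
                      (cons a nil ∷ unary (n + m) ∷ []) (repeated 3 (4 » 7) n)
countRows-runs {zero}  f a m = doneRuns (4 » 7) refl
countRows-runs {suc n} f a m = againRuns {m = n} cons≢nil (set ▸ set)
  (subst (λ l → Runs countRows (cons a (encodeVec id (tabulate (f ∘ suc))) ∷ unary (suc m) ∷ [])
                     (cons a nil ∷ unary l ∷ []) (repeated 3 (4 » 7) n))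
         (+-suc n m) (countRows-runs (f ∘ suc) a (suc m)))

programCost : Term (vec (vec bool) ∷ []) (vec bool) → ℕ → ℕ
programCost t n = 4 » repeated 3 (4 » 7) n » 5 » 2 » cost t n

programCost-poly : ∀ t → PolyBounded (programCost t)
programCost-poly t =
  »-poly (const-poly 4) (»-poly (repeated-poly 3 (const-poly (4 » 7)))
    (»-poly (const-poly 5) (»-poly (const-poly 2) (cost-poly t))))

toProgram-runs : ∀ t {n} (M : ⟦ vec (vec bool) ⟧ n) →
                 Runs (body (toProgram t)) (encode (vec (vec bool)) M ∷ nil ∷ [])
                      (encode (vec bool) (⟦ t ⟧ᵗ (M , tt)) ∷ nil ∷ []) (programCost t n)
toProgram-runs t {n} M =
  set {zero} {cons x x} ▸ countRows-runs (encode (vec bool) ∘ M) (encode (vec (vec bool)) M) 0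
  ▸ setx (cong (cons (encode (vec (vec bool)) M) ∘ unary) (+-identityʳ n)) ▸ sets refl
  ▸ compile-correct t (M , tt) nil

toProgram-outputs :
  ∀ t → ∃[ c ] ∃[ k ] ∀ {n} (G : Graph n) →
    ∃[ m ] Outputs (toProgram t) (encodeGraph G) (encodeSubset (tabulate (⟦ t ⟧ᵗ (adj G , tt)))) m
         × m ≤ c * size (encodeGraph G) ^ k
toProgram-outputs t = c , k , λ G →
  subst (λ input → ∃[ m ] Outputs (toProgram t) input (encodeSubset (tabulate (⟦ t ⟧ᵗ (adj G , tt)))) m
                        × m ≤ c * size input ^ k)
        (sym (encodeGraph-matrix G)) (outputs (adj G))
  where
  c k : ℕ
  c = proj₁ (programCost-poly t)
  k = proj₁ (proj₂ (programCost-poly t))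

  outputs : ∀ {n} (M : ⟦ vec (vec bool) ⟧ n) →
            ∃[ m ] Outputs (toProgram t) (encode (vec (vec bool)) M)
                           (encodeSubset (tabulate (⟦ t ⟧ᵗ (M , tt)))) m
                 × m ≤ c * size (encode (vec (vec bool)) M) ^ k
  outputs {n} M = let m , run , m≤ = toProgram-runs t M in
    m , (_ , run , sym (encodeVec-tabulate encodeBool (⟦ t ⟧ᵗ (M , tt)))) ,
    ≤-trans m≤ (≤-trans (proj₂ (proj₂ (programCost-poly t)) n)
                        (*-monoʳ-≤ c (^-monoˡ-≤ k (n<size (encode (vec bool) ∘ M)))))

-- The algorithm as a term

pattern v0 = here
pattern v1 = there v0
pattern v2 = there v1
pattern v3 = there v2
pattern v4 = there v3
pattern v5 = there v4
pattern v6 = there v5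

Setᵗ Matᵗ Stateᵗ : Ty
Setᵗ   = vec bool
Matᵗ   = vec Setᵗ
Stateᵗ = vec num ⊗ vec num ⊗ num ⊗ Setᵗ

notᵗ : ∀ {Γ} → Term Γ bool → Term Γ bool
notᵗ b = cond b (bit false) (bit true)

andᵗ orᵗ : ∀ {Γ} → Term Γ bool → Term Γ bool → Term Γ bool
andᵗ b c = cond b c (bit false)
orᵗ  b c = cond b (bit true) c

at : ∀ {Γ τ} → Γ ∋ vec τ → Γ ∋ fin → Term Γ τ
at f i = app index (pair (var f) (var i))

at₂ : ∀ {Γ τ} → Γ ∋ vec (vec τ) → Γ ∋ fin → Γ ∋ fin → Term Γ τ
at₂ f i j = app index (pair (at f i) (var j))

eqᵗ : ∀ {Γ} → Γ ∋ fin → Γ ∋ fin → Term Γ bool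
eqᵗ i j = andᵗ (notᵗ (app pos (app monus (pair (var i) (var j)))))
               (notᵗ (app pos (app monus (pair (var j) (var i)))))

closedᵗ : Term (Matᵗ ∷ []) Matᵗ
closedᵗ = tab (tab (orᵗ (at₂ v2 v1 v0) (eqᵗ v1 v0)))

nonisolatedᵗ : Term (Matᵗ ∷ []) Setᵗ
nonisolatedᵗ = tab (loop (bit false) (orᵗ (at₂ v3 v2 v0) (var v1)))

-- The state holds the weights X, the deficits T − X(N[v]), the gap between
-- the total weight of the recorded solution and that of X, and the recorded set.
weightsᵗ : ∀ {Γ} → Term Γ Stateᵗ → Term Γ (vec num)
weightsᵗ t = app fst t

deficitsᵗ : ∀ {Γ} → Term Γ Stateᵗ → Term Γ (vec num)
deficitsᵗ t = app fst (app snd t)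

gapᵗ : ∀ {Γ} → Term Γ Stateᵗ → Term Γ num
gapᵗ t = app fst (app snd (app snd t))

recordedᵗ : ∀ {Γ} → Term Γ Stateᵗ → Term Γ Setᵗ
recordedᵗ t = app snd (app snd (app snd t))

-- `o` moves the weights on the set by one, and `o′` makes the opposite move in the deficits and the
-- gap, once for each element concerned. No weights have to be summed anew.
shiftᵗ : Op num num → Op num num → Term (Setᵗ ∷ Stateᵗ ∷ Matᵗ ∷ []) Stateᵗ
shiftᵗ o o′ =
  pair (tab (bind (app index (pair (weightsᵗ (var v2)) (var v0)))
         (cond (at v2 v1) (app o (var v0)) (var v0))))
  (pair (tab (loop (app index (pair (deficitsᵗ (var v2)) (var v0)))
         (cond (andᵗ (at₂ v5 v2 v0) (at v3 v0)) (app o′ (var v1)) (var v1))))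
  (pair (loop (gapᵗ (var v1)) (cond (at v2 v0) (app o′ (var v1)) (var v1)))
        (recordedᵗ (var v1))))

shortᵗ : Term (fin ∷ Stateᵗ ∷ []) bool
shortᵗ = app pos (app index (pair (deficitsᵗ (var v1)) (var v0)))

violatedᵗ : Term (fin ∷ fin ∷ Stateᵗ ∷ Matᵗ ∷ []) bool
violatedᵗ = andᵗ (at₂ v3 v0 v1) (andᵗ (call (v0 ∷ v2 ∷ []) shortᵗ) (call (v1 ∷ v2 ∷ []) shortᵗ))

anyViolatedᵗ : Term (Stateᵗ ∷ Matᵗ ∷ []) bool
anyViolatedᵗ =
  loop (bit false) (loop (var v1) (orᵗ (call (v2 ∷ v0 ∷ v4 ∷ v5 ∷ []) violatedᵗ) (var v1)))

-- Context: the state, the closed neighbourhoods, the adjacency matrix.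
sweepᵗ : Term (Stateᵗ ∷ Matᵗ ∷ Matᵗ ∷ []) Stateᵗ
sweepᵗ = loop (var v0) (loop (var v1)
  (cond (call (v2 ∷ v0 ∷ v1 ∷ v6 ∷ []) violatedᵗ)
        (bind (at v5 v2) (bind (call (v0 ∷ v2 ∷ v6 ∷ []) (shiftᵗ inc dec))
          (bind (at (there v6) v2) (call (v0 ∷ v1 ∷ there (there v6) ∷ []) (shiftᵗ inc dec)))))
        (var v1)))

-- Called only when no edge has two short ends, so that the vertices that are not short form a
-- vertex cover. A positive gap means that the current weights are lighter than the recorded ones.
recordᵗ : Term (Stateᵗ ∷ []) Stateᵗ
recordᵗ = cond (app pos (gapᵗ (var v0)))
  (pair (weightsᵗ (var v0)) (pair (deficitsᵗ (var v0))
    (pair zero (tab (notᵗ (call (v0 ∷ v1 ∷ []) shortᵗ))))))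
  (var v0)

roundᵗ : Term (Stateᵗ ∷ Matᵗ ∷ Matᵗ ∷ []) Stateᵗ
roundᵗ = cond (call (v0 ∷ v2 ∷ []) anyViolatedᵗ) sweepᵗ
  (bind (call (v0 ∷ []) recordᵗ)
    (bind (tab (app pos (app index (pair (weightsᵗ (var v1)) (var v0)))))
      (call (v0 ∷ v1 ∷ v3 ∷ []) (shiftᵗ dec inc))))

-- n ^ k iterations
repeatᵗ : ∀ {τ} → ℕ → Term (τ ∷ Matᵗ ∷ Matᵗ ∷ []) τ → Term (τ ∷ Matᵗ ∷ Matᵗ ∷ []) τ
repeatᵗ zero    t = t
repeatᵗ (suc k) t = loop (var v0) (call (v1 ∷ v3 ∷ v4 ∷ []) (repeatᵗ k t))

-- All weights are zero, so every deficit is the threshold `n ^ a`. The gap `n ^ b` stands for a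
-- fictitious recorded weighting of that total, with all vertices as its cover.
initialᵗ : ℕ → ℕ → Term (Matᵗ ∷ Matᵗ ∷ []) Stateᵗ
initialᵗ a b =
  pair (tab zero)
  (pair (bind zero (bind (repeatᵗ a (app inc (var v0))) (tab (var v1))))
  (pair (bind zero (repeatᵗ b (app inc (var v0))))
        (tab (bit true))))

coverᵗ : ℕ → ℕ → ℕ → Term (Matᵗ ∷ Matᵗ ∷ []) Setᵗ
coverᵗ a b c = bind (initialᵗ a b) (recordedᵗ (repeatᵗ c roundᵗ))

-- Context: the candidate neighbour w of v, v, the growing set L, the closed
-- neighbourhoods.
Extraᵗ : Set
Extraᵗ = Term (fin ∷ fin ∷ Setᵗ ∷ Matᵗ ∷ []) bool

selfᵗ centralᵗ anyᵗ : Extraᵗ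
selfᵗ    = eqᵗ v1 v0
centralᵗ = loop (bit true)
  (andᵗ (cond (andᵗ (at₂ v5 v3 v0) (at v4 v0)) (at₂ v5 v2 v0) (bit true)) (var v1))
anyᵗ     = bit true

countdownᵗ : ∀ {Γ} → ℕ → Term Γ num
countdownᵗ zero    = zero
countdownᵗ (suc k) = app inc (countdownᵗ k)

sparseᵗ : ℕ → Term (fin ∷ Setᵗ ∷ Matᵗ ∷ []) bool
sparseᵗ k = app pos (loop (countdownᵗ k)
  (cond (andᵗ (at₂ v4 v2 v0) (at v3 v0)) (app dec (var v1)) (var v1)))

eligibleᵗ : ℕ → Extraᵗ → Term (fin ∷ fin ∷ Setᵗ ∷ Matᵗ ∷ Setᵗ ∷ []) bool
eligibleᵗ k extra =
  andᵗ (at v4 v1) (andᵗ (at₂ v3 v1 v0) (andᵗ (notᵗ (at v2 v0))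
    (andᵗ (call (v1 ∷ v2 ∷ v3 ∷ []) (sparseᵗ k)) (call (v0 ∷ v1 ∷ v2 ∷ v3 ∷ []) extra))))

insertᵗ : Term (fin ∷ Setᵗ ∷ []) Setᵗ
insertᵗ = tab (orᵗ (at v2 v0) (eqᵗ v0 v1))

passᵗ : ℕ → Extraᵗ → Term (Setᵗ ∷ Matᵗ ∷ Setᵗ ∷ []) Setᵗ
passᵗ k extra = loop (var v0) (loop (var v1)
  (cond (call (v0 ∷ v2 ∷ v1 ∷ v5 ∷ v6 ∷ []) (eligibleᵗ k extra))
        (call (v0 ∷ v1 ∷ []) insertᵗ) (var v1)))

layerᵗ : ℕ → Term (Setᵗ ∷ Matᵗ ∷ Setᵗ ∷ []) Setᵗ
layerᵗ k =
  bind (passᵗ k selfᵗ) (bind (call (v0 ∷ v2 ∷ v3 ∷ []) (passᵗ k centralᵗ))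
    (call (v0 ∷ v3 ∷ v4 ∷ []) (passᵗ k anyᵗ)))

layersᵗ : Term (Setᵗ ∷ Matᵗ ∷ Setᵗ ∷ []) Setᵗ
layersᵗ = bind (layerᵗ 1) (bind (call (v0 ∷ v2 ∷ v3 ∷ []) (layerᵗ 2))
  (call (v0 ∷ v3 ∷ v4 ∷ []) (layerᵗ 3)))

liarᵗ : ℕ → ℕ → ℕ → Term (Matᵗ ∷ []) Setᵗ
liarᵗ a b c =
  bind closedᵗ (bind (coverᵗ a b c) (bind (call (v2 ∷ []) nonisolatedᵗ)
    (bind (tab (andᵗ (at v2 v0) (at v1 v0)))
      (bind (tab (bit false)) (call (v0 ∷ v4 ∷ v1 ∷ []) layersᵗ)))))

-- Boolean sets and loops over Fin n

infixr 6 _and_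
infixr 5 _or_

-- Written with `ifᵇ` like the meanings of `andᵗ` and `orᵗ`, so that the meaning of the whole
-- algorithm unfolds to these operations by computation.
_and_ _or_ : Bool → Bool → Bool
a and b = ifᵇ a then b else false
a or b  = ifᵇ a then true else b

neg : Bool → Bool
neg a = ifᵇ a then false else true

and-true : ∀ {a b} → a and b ≡ true → a ≡ true × b ≡ true
and-true {true} p = refl , p

true-and : ∀ {a b} → a ≡ true → b ≡ true → a and b ≡ true
true-and refl q = q

or-true : ∀ {a b} → a or b ≡ true → a ≡ true ⊎ b ≡ true
or-true {true}  p = inj₁ refl
or-true {false} p = inj₂ p

true-orˡ : ∀ {a b} → a ≡ true → a or b ≡ true
true-orˡ refl = refl

true-orʳ : ∀ {a b} → b ≡ true → a or b ≡ true
true-orʳ {true}  p = refl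
true-orʳ {false} p = p

neg-true : ∀ {a} → neg a ≡ true → a ≡ false
neg-true {false} p = refl

true-neg : ∀ {a} → a ≡ false → neg a ≡ true
true-neg refl = refl

true≢false : ∀ {a} → a ≡ true → a ≡ false → ⊥
true≢false refl ()

≢true : ∀ {a} → (a ≡ true → ⊥) → a ≡ false
≢true {true}  p = ⊥-elim (p refl)
≢true {false} p = refl

true? : ∀ a → a ≡ true ⊎ a ≡ false
true? true  = inj₁ refl
true? false = inj₂ refl

BSet : ℕ → Set
BSet n = Fin n → Bool

infix 4 _∈_ _∉_ _⊆_

_∈_ _∉_ : ∀ {n} → Fin n → BSet n → Set
v ∈ A = A v ≡ true
v ∉ A = A v ≡ false

_⊆_ : ∀ {n} → BSet n → BSet n → Set
A ⊆ B = ∀ v → v ∈ A → v ∈ B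

∉-⊆ : ∀ {n} (A B : BSet n) → A ⊆ B → ∀ {v} → v ∉ B → v ∉ A
∉-⊆ A B A⊆B {v} v∉B = ≢true (λ v∈A → true≢false (A⊆B v v∈A) v∉B)

∈∉⇒≢ : ∀ {n} (A : BSet n) {u v} → u ∈ A → v ∉ A → u ≢ v
∈∉⇒≢ A u∈A v∉A refl = true≢false u∈A v∉A

infixr 7 _∩ᵇ_

∅ : ∀ {n} → BSet n
∅ _ = false

_∩ᵇ_ : ∀ {n} → BSet n → BSet n → BSet n
(A ∩ᵇ B) v = A v and B v

-- The meaning of `eqᵗ`: two indices are compared through both truncated differences.
same : ∀ {n} → Fin n → Fin n → Bool
same i j = neg (isPositive (+ (toℕ i ∸ toℕ j))) and neg (isPositive (+ (toℕ j ∸ toℕ i)))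

insert : ∀ {n} → Fin n → BSet n → BSet n
insert w A u = A u or same u w

same-refl : ∀ {n} (i : Fin n) → same i i ≡ true
same-refl zero    = refl
same-refl (suc i) = same-refl i

same-≡ : ∀ {n} {i j : Fin n} → same i j ≡ true → i ≡ j
same-≡ {i = zero}  {zero}  p = refl
same-≡ {i = suc i} {suc j} p = cong suc (same-≡ p)

∈-insert : ∀ {n} (w : Fin n) A → w ∈ insert w A
∈-insert w A = true-orʳ {A w} (same-refl w)

⊆-insert : ∀ {n} (w : Fin n) A → A ⊆ insert w A
⊆-insert w A v v∈A = true-orˡ v∈A

insert-cases : ∀ {n} (w : Fin n) A {v} → v ∈ insert w A → v ∈ A ⊎ v ≡ w
insert-cases w A {v} v∈ with or-true {A v} v∈
... | inj₁ v∈A = inj₁ v∈A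
... | inj₂ v≡w = inj₂ (same-≡ v≡w)

∩-mono : ∀ {n} (D A B : BSet n) → A ⊆ B → D ∩ᵇ A ⊆ D ∩ᵇ B
∩-mono D A B A⊆B v v∈ with p , q ← and-true {D v} v∈ = true-and p (A⊆B v q)

toBit : Bool → ℕ
toBit b = ifᵇ b then 1 else 0

count : ∀ {n} → BSet n → ℕ
count {zero}  A = 0
count {suc n} A = toBit (A zero) + count (A ∘ suc)

toBit-mono : ∀ {a b} → (a ≡ true → b ≡ true) → toBit a ≤ toBit b
toBit-mono {false} p = z≤n
toBit-mono {true}  p rewrite p refl = ≤-refl

count-mono : ∀ {n} (A B : BSet n) → A ⊆ B → count A ≤ count B
count-mono {zero}  A B A⊆B = z≤n
count-mono {suc n} A B A⊆B =
  +-mono-≤ (toBit-mono (A⊆B zero)) (count-mono (A ∘ suc) (B ∘ suc) (A⊆B ∘ suc))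

count-strict : ∀ {n} (A B : BSet n) {x} → A ⊆ B → x ∈ B → x ∉ A → count A < count B
count-strict A B {zero}  A⊆B x∈B x∉A rewrite x∈B | x∉A =
  s≤s (count-mono (A ∘ suc) (B ∘ suc) (A⊆B ∘ suc))
count-strict A B {suc x} A⊆B x∈B x∉A =
  +-mono-≤-< (toBit-mono (A⊆B zero)) (count-strict (A ∘ suc) (B ∘ suc) (A⊆B ∘ suc) x∈B x∉A)

count-∅ : ∀ n → count {n} ∅ ≡ 0
count-∅ zero    = refl
count-∅ (suc n) = count-∅ n

or-false : ∀ a → a or false ≡ a
or-false true  = refl
or-false false = refl

count-cong : ∀ {n} (A B : BSet n) → (∀ v → A v ≡ B v) → count A ≡ count B
count-cong {zero}  A B p = refl
count-cong {suc n} A B p = cong₂ _+_ (cong toBit (p zero)) (count-cong (A ∘ suc) (B ∘ suc) (p ∘ suc))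

count-insert : ∀ {n} (A : BSet n) x → x ∉ A → count (insert x A) ≡ suc (count A)
count-insert A zero    x∉A rewrite x∉A = cong suc (count-cong _ (A ∘ suc) (or-false ∘ A ∘ suc))
count-insert A (suc x) x∉A =
  trans (cong₂ _+_ (cong toBit (or-false (A zero))) (count-insert (A ∘ suc) x x∉A)) (+-suc _ _)

insert-⊆ : ∀ {n} (w : Fin n) A B → A ⊆ B → w ∈ B → insert w A ⊆ B
insert-⊆ w A B A⊆B w∈B v v∈ with insert-cases w A v∈
... | inj₁ v∈A  = A⊆B v v∈A
... | inj₂ refl = w∈B

count-insert-≤ : ∀ {n} (A : BSet n) x → count (insert x A) ≤ suc (count A)
count-insert-≤ A x with true? (A x)
... | inj₂ x∉A = ≤-reflexive (count-insert A x x∉A)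
... | inj₁ x∈A = m≤n⇒m≤1+n (count-mono (insert x A) A (insert-⊆ x A A (λ _ → id) x∈A))

count≤2 : ∀ {n} (A : BSet n) u v → (∀ z → z ∈ A → z ≡ u ⊎ z ≡ v) → count A ≤ 2
count≤2 {n} A u v only = begin
  count A                           ≤⟨ count-mono A (insert u (insert v ∅)) (λ z z∈A → inPair (only z z∈A)) ⟩
  count (insert u (insert v ∅))     ≤⟨ count-insert-≤ (insert v ∅) u ⟩
  suc (count (insert v ∅))          ≤⟨ s≤s (count-insert-≤ ∅ v) ⟩
  2 + count {n} ∅                   ≡⟨ cong (λ m → suc (suc m)) (count-∅ n) ⟩
  2                                 ∎
  where
  open ≤-Reasoning
  inPair : ∀ {z} → z ≡ u ⊎ z ≡ v → z ∈ insert u (insert v ∅)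
  inPair (inj₁ refl) = ∈-insert u (insert v ∅)
  inPair (inj₂ refl) = ⊆-insert u (insert v ∅) v (∈-insert v ∅)

∉-insert : ∀ {n} (w : Fin n) A {v} → v ∉ A → v ≢ w → v ∉ insert w A
∉-insert w A v∉A v≢w = ≢true λ v∈ →
  [ (λ v∈A → true≢false v∈A v∉A) , v≢w ]′ (insert-cases w A v∈)

3≤count : ∀ {n} (A : BSet n) {a b c} → a ∈ A → b ∈ A → c ∈ A →
          a ≢ b → a ≢ c → b ≢ c → 3 ≤ count A
3≤count {n} A {a} {b} {c} a∈ b∈ c∈ a≢b a≢c b≢c = begin
  3                         ≡⟨ cong (λ m → suc (suc (suc m))) (count-∅ n) ⟨
  3 + count {n} ∅           ≡⟨ cong (λ m → suc (suc m)) (count-insert ∅ c refl) ⟨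
  2 + count C               ≡⟨ cong suc (count-insert C b (∉-insert c ∅ refl b≢c)) ⟨
  1 + count (insert b C)    ≡⟨ count-insert (insert b C) a (∉-insert b C (∉-insert c ∅ refl a≢c) a≢b) ⟨
  count (insert a (insert b C))
    ≤⟨ count-mono _ A (insert-⊆ a (insert b C) A (insert-⊆ b C A (insert-⊆ c ∅ A (λ _ ()) c∈) b∈) a∈) ⟩
  count A                   ∎
  where
  open ≤-Reasoning
  C = insert c ∅

-- Supplies the leaves of a star, so that a bound on stars becomes a bound on `count`.
enumerate : ∀ {n} (A : BSet n) → ∃[ f ] Injective {A = Fin (count A)} {B = Fin n} _≡_ _≡_ f × (∀ i → f i ∈ A)
enumerate {zero}  A = (λ ()) , (λ { {()} }) , λ ()
enumerate {suc n} A with A zero in eq | enumerate (A ∘ suc)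
... | false | f , inj , mem = suc ∘ f , (λ p → inj (sucᶠ-injective p)) , mem
... | true  | f , inj , mem = g , g-injective , g-member
  where
  g : Fin (suc (count (A ∘ suc))) → Fin (suc n)
  g zero    = zero
  g (suc i) = suc (f i)
  g-injective : Injective _≡_ _≡_ g
  g-injective {zero}  {zero}  p = refl
  g-injective {suc i} {suc j} p = cong suc (inj (sucᶠ-injective p))
  g-member : ∀ i → A (g i) ≡ true
  g-member zero    = eq
  g-member (suc i) = mem i

for-invariant : ∀ {S : Set} {n} {f : Fin n → S → S} (P : S → Set) →
                (∀ i {a} → P a → P (f i a)) → ∀ {a} → P a → P (for f a)
for-invariant {n = zero}  P step p = p
for-invariant {n = suc n} P step p = step zero (for-invariant P (λ i → step (suc i)) p)

-- For facts that one particular round brings about and the later ones preserve, under an invariant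
-- `P` of the whole loop.
for-reach : ∀ {S : Set} {n} {f : Fin n → S → S} (P Q : S → Set) → (∀ j {a} → P a → P (f j a)) →
            (∀ j {a} → P a → Q a → Q (f j a)) → ∀ i → (∀ {a} → P a → Q (f i a)) →
            ∀ {a} → P a → Q (for f a)
for-reach {n = suc n} P Q keepP keepQ zero    hit p = hit (for-invariant P (λ j → keepP (suc j)) p)
for-reach {n = suc n} P Q keepP keepQ (suc i) hit p =
  keepQ zero (for-invariant P (λ j → keepP (suc j)) p)
             (for-reach P Q (λ j → keepP (suc j)) (λ j → keepQ (suc j)) i hit p)

-- The loops for sparsity, deficits and gap all have this shape.
for-add : ∀ {n} (A : BSet n) δ z →
          for (λ u a → ifᵇ A u then δ ℤ.+ a else a) z ≡ z ℤ.+ δ ℤ.* + count A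
for-add {zero}  A δ z = regroup δ z
  where
  regroup : ∀ δ z → z ≡ z ℤ.+ δ ℤ.* + 0
  regroup = ℤ-Solver.solve-∀
for-add {suc n} A δ z with A zero
... | false = for-add (A ∘ suc) δ z
... | true  = trans (cong (λ m → δ ℤ.+ m) (for-add (A ∘ suc) δ z)) (regroup δ z (+ count (A ∘ suc)))
  where
  regroup : ∀ δ z c → δ ℤ.+ (z ℤ.+ δ ℤ.* c) ≡ z ℤ.+ δ ℤ.* (ℤ.1ℤ ℤ.+ c)
  regroup = ℤ-Solver.solve-∀

isPositive-sound : ∀ {z} → isPositive z ≡ true → ℤ.0ℤ ℤ.< z
isPositive-sound {+ suc n} p = ℤ.+<+ (s≤s z≤n)

isPositive-complete : ∀ {z} → ℤ.0ℤ ℤ.< z → isPositive z ≡ true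
isPositive-complete {+ suc n} p = refl
isPositive-complete {+ zero} (ℤ.+<+ ())

0<a-b⇒b<a : ∀ {a b} → ℤ.0ℤ ℤ.< a ℤ.- b → b ℤ.< a
0<a-b⇒b<a {a} {b} p = subst₂ ℤ._<_ (ℤ.+-identityʳ b) (cancel a b) (ℤ.+-monoʳ-< b p)
  where
  cancel : ∀ a b → b ℤ.+ (a ℤ.- b) ≡ a
  cancel = ℤ-Solver.solve-∀

b<a⇒0<a-b : ∀ {a b} → b ℤ.< a → ℤ.0ℤ ℤ.< a ℤ.- b
b<a⇒0<a-b {a} {b} p = subst (ℤ._< a ℤ.- b) (ℤ.+-inverseʳ b) (ℤ.+-monoˡ-< (ℤ.- b) p)

-- Greedy passes that enlarge a set

module Passes {n : ℕ} (N : Fin n → BSet n) (C : BSet n) where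

  Extra : Set
  Extra = Fin n → Fin n → BSet n → Bool

  sparse : ℕ → Fin n → BSet n → Bool
  sparse k v L = isPositive (for (λ u a → ifᵇ (N v ∩ᵇ L) u then ℤ.pred a else a) (+ k))

  eligible : ℕ → Extra → BSet n → Fin n → Fin n → Bool
  eligible k extra L v w =
    C v and N v w and neg (L w) and sparse k v L and extra v w L

  sweepBody : ℕ → Extra → Fin n → Fin n → BSet n → BSet n
  sweepBody k extra v w L = ifᵇ eligible k extra L v w then insert w L else L

  sweepRow : ℕ → Extra → Fin n → BSet n → BSet n
  sweepRow k extra v L = for (sweepBody k extra v) L

  pass : ℕ → Extra → BSet n → BSet n
  pass k extra L = for (sweepRow k extra) L

  self central any : Extra
  self v w L    = same v w
  central v w L = for (λ u a → (ifᵇ N v u and L u then N w u else true) and a) true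
  any v w L     = true

  sparse-sound : ∀ {k v L} → sparse k v L ≡ true → count (N v ∩ᵇ L) < k
  sparse-sound {k} {v} {L} p rewrite for-add (N v ∩ᵇ L) ℤ.-1ℤ (+ k) | ℤ.-1*i≡-i (+ count (N v ∩ᵇ L)) =
    ℤ.drop‿+<+ (0<a-b⇒b<a (isPositive-sound p))

  sparse-complete : ∀ {k v L} → count (N v ∩ᵇ L) < k → sparse k v L ≡ true
  sparse-complete {k} {v} {L} p rewrite for-add (N v ∩ᵇ L) ℤ.-1ℤ (+ k) | ℤ.-1*i≡-i (+ count (N v ∩ᵇ L)) =
    isPositive-complete (b<a⇒0<a-b (ℤ.+<+ p))

  record Eligible (k : ℕ) (extra : Extra) (L : BSet n) (v w : Fin n) : Set where
    constructor eligibly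
    field
      isCandidate : v ∈ C
      isClose     : w ∈ N v
      isNew       : w ∉ L
      isSparse    : count (N v ∩ᵇ L) < k
      isExtra     : extra v w L ≡ true

  eligible-sound : ∀ {k extra L v w} → eligible k extra L v w ≡ true → Eligible k extra L v w
  eligible-sound p
    with c , p ← and-true p
    with d , p ← and-true p
    with e , p ← and-true p
    with f , g ← and-true p = eligibly c d (neg-true e) (sparse-sound f) g

  eligible-complete : ∀ {k extra L v w} → Eligible k extra L v w → eligible k extra L v w ≡ true
  eligible-complete {L = L} (eligibly c d e f g) =
    true-and c (true-and d (true-and (true-neg e) (true-and (sparse-complete f) g)))

  central-sound : ∀ {v w L} → central v w L ≡ true → ∀ u → u ∈ N v → u ∈ L → u ∈ N w
  central-sound {v} {w} {L} p u u∈N u∈L =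
    for-reach (λ _ → ⊤) (λ a → a ≡ true → u ∈ N w) _ (λ j _ r e → r (proj₂ (and-true e))) u
      (λ _ e → atᵤ (proj₁ (and-true e))) tt p
    where
    atᵤ : (ifᵇ N v u and L u then N w u else true) ≡ true → u ∈ N w
    atᵤ e rewrite u∈N | u∈L = e

  central-complete : ∀ {v w L} → (∀ u → u ∈ N v → u ∈ L → u ∈ N w) → central v w L ≡ true
  central-complete {v} {w} {L} p = for-invariant (_≡ true) (λ u a → true-and (atᵤ u (true? (N v u and L u))) a) refl
    where
    atᵤ : ∀ u → (N v u and L u ≡ true) ⊎ (N v u and L u ≡ false) →
           (ifᵇ N v u and L u then N w u else true) ≡ true
    atᵤ u (inj₁ e) rewrite e = p u (proj₁ (and-true e)) (proj₂ (and-true {N v u} e))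
    atᵤ u (inj₂ e) rewrite e = refl

  Antitone : Extra → Set
  Antitone extra = ∀ {L L′ v w} → L ⊆ L′ → extra v w L′ ≡ true → extra v w L ≡ true

  central-antitone : Antitone central
  central-antitone L⊆L′ p = central-complete (λ u u∈N u∈L → central-sound p u u∈N (L⊆L′ u u∈L))

  module Pass (k : ℕ) (extra : Extra) where

    sweepBody-invariant : ∀ (P : BSet n → Set) →
                          (∀ {L v w} → P L → Eligible k extra L v w → P (insert w L)) →
                          ∀ {v w L} → P L → P (sweepBody k extra v w L)
    sweepBody-invariant P step {v} {w} {L} p with eligible k extra L v w in eq
    ... | true  = step p (eligible-sound eq)
    ... | false = p

    pass-invariant : ∀ (P : BSet n → Set) →
                     (∀ {L v w} → P L → Eligible k extra L v w → P (insert w L)) →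
                     ∀ {L} → P L → P (pass k extra L)
    pass-invariant P step =
      for-invariant {f = sweepRow k extra} P
        (λ v → for-invariant {f = sweepBody k extra v} P (λ w → sweepBody-invariant P step))

    -- A pair that is not eligible stays so while the set grows, and treating a pair makes it
    -- ineligible. A single sweep over all pairs therefore leaves none.
    pass-done : Antitone extra → ∀ {L v w} → ¬ Eligible k extra (pass k extra L) v w
    pass-done antitone {L} {v} {w} =
      for-reach {f = sweepRow k extra} (λ _ → ⊤) Done _
        (λ j _ → for-invariant {f = sweepBody k extra j} Done (λ _ → keep)) v
        (λ _ → for-reach {f = sweepBody k extra v} (λ _ → ⊤) Done _ (λ _ _ → keep) w (λ _ → hit) tt) tt
      where
      Done : BSet n → Set
      Done L = ¬ Eligible k extra L v w
      keep : ∀ {v′ w′ L} → Done L → Done (sweepBody k extra v′ w′ L)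
      keep = sweepBody-invariant Done λ {L} {_} {x} done _ (eligibly c d e f g) →
        done (eligibly c d (∉-⊆ L (insert x L) (⊆-insert x L) e)
               (≤-<-trans (count-mono (N v ∩ᵇ L) (N v ∩ᵇ insert x L)
                             (∩-mono (N v) L (insert x L) (⊆-insert x L))) f)
               (antitone (⊆-insert x L) g))
      hit : ∀ {L} → Done (sweepBody k extra v w L)
      hit {L} el with eligible k extra L v w in eq
      ... | true  = true≢false (∈-insert w L) (Eligible.isNew el)
      ... | false = true≢false (eligible-complete el) eq

-- The three layers

-- N is a closed neighbourhood relation and q bounds the stars with pairwise
-- non-adjacent leaves.
module Layers
  {n : ℕ} (N : Fin n → BSet n) (C : BSet n) (q : ℕ)
  (N-refl : ∀ v → v ∈ N v) (N-sym : ∀ {u v} → v ∈ N u → u ∈ N v)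
  (star : ∀ {l} (f : Fin l → Fin n) m → Injective _≡_ _≡_ f → (∀ i → f i ∈ N m) → (∀ i → f i ≢ m) →
          (∀ i j → i ≢ j → f j ∉ N (f i)) → l ≤ q)
  (nonisolated : ∀ {v} → v ∈ C → ∃[ u ] u ∈ N v × u ≢ v)
  where

  open Passes N C
  open Eligible

  Saturated : ℕ → BSet n → Set
  Saturated k L = ∀ {v} → v ∈ C → N v ⊆ L ⊎ k ≤ count (N v ∩ᵇ L)

  module Layer (k : ℕ) (k≤2 : k ≤ 2) (L₀ : BSet n) (saturated : Saturated k L₀) where

    L₁ L₂ L₃ : BSet n
    L₁ = pass (suc k) self L₀
    L₂ = pass (suc k) central L₁
    L₃ = pass (suc k) any L₂

    deficit : ∀ {v w} → v ∈ C → w ∈ N v → w ∉ L₀ → k ≤ count (N v ∩ᵇ L₀)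
    deficit v∈C w∈N w∉L₀ with saturated v∈C
    ... | inj₁ N⊆L₀ = ⊥-elim (true≢false (N⊆L₀ _ w∈N) w∉L₀)
    ... | inj₂ k≤   = k≤

    -- Saturation puts `k` elements of `L₀` into `N v`, and `u` is one more. So a vertex ceases to
    -- be sparse as soon as its neighbourhood receives anything new in this layer.
    gain : ∀ {L v w u} → L₀ ⊆ L → v ∈ C → w ∈ N v → w ∉ L₀ → u ∈ N v → u ∈ L → u ∉ L₀ →
           k < count (N v ∩ᵇ L)
    gain {L} {v} L₀⊆L v∈C w∈N w∉L₀ u∈N u∈L u∉L₀ =
      ≤-<-trans (deficit v∈C w∈N w∉L₀)
        (count-strict (N v ∩ᵇ L₀) (N v ∩ᵇ L) (∩-mono (N v) L₀ L L₀⊆L) (true-and u∈N u∈L)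
          (≢true (λ p → true≢false (proj₂ (and-true p)) u∉L₀)))

    record First (L : BSet n) : Set where
      field
        Q           : BSet n
        size≡       : count L ≡ count L₀ + count Q
        grows       : L₀ ⊆ L
        Q⊆C         : Q ⊆ C
        Q⊆L         : Q ⊆ L
        fresh       : ∀ {v} → v ∈ Q → v ∉ L₀
        independent : ∀ {u v} → u ∈ Q → v ∈ Q → u ≢ v → v ∉ N u

    charge-size : ∀ (L Q : BSet n) v w → count L ≡ count L₀ + count Q → w ∉ L → v ∉ Q →
                  count (insert w L) ≡ count L₀ + count (insert v Q)
    charge-size L Q v w eq w∉L v∉Q =
      trans (count-insert L w w∉L) (trans (cong suc eq)
        (trans (sym (+-suc _ _)) (cong (λ m → count L₀ + m) (sym (count-insert Q v v∉Q)))))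

    -- In this pass `w` is `v`. An element of `Q` in `N v` would be a new element of `N v`, and by
    -- `gain` `v` would not be sparse; this keeps `Q` independent.
    first-step : ∀ {L v w} → First L → Eligible (suc k) self L v w → First (insert w L)
    first-step {L} {v} {w} F el with refl ← same-≡ {i = v} {w} (isExtra el) = record
      { Q           = insert v Q
      ; size≡       = charge-size L Q v v size≡ (isNew el) v∉Q
      ; grows       = λ u u∈ → ⊆-insert v L u (grows u u∈)
      ; Q⊆C         = insert-⊆ v Q C Q⊆C (isCandidate el)
      ; Q⊆L         = insert-⊆ v Q (insert v L) (λ u u∈ → ⊆-insert v L u (Q⊆L u u∈)) (∈-insert v L)
      ; fresh       = λ u∈ → [ fresh , (λ { refl → v∉L₀ }) ]′ (insert-cases v Q u∈)
      ; independent = λ a∈ b∈ → split (insert-cases v Q a∈) (insert-cases v Q b∈)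
      }
      where
      open First F
      v∉L₀ : v ∉ L₀
      v∉L₀ = ∉-⊆ L₀ L grows (isNew el)
      v∉Q : v ∉ Q
      v∉Q = ∉-⊆ Q L Q⊆L (isNew el)
      separate : ∀ {u} → u ∈ Q → u ∉ N v
      separate u∈Q = ≢true λ u∈N → <⇒≱ (gain grows (isCandidate el) (isClose el) v∉L₀ u∈N (Q⊆L _ u∈Q) (fresh u∈Q))
                                     (s≤s⁻¹ (isSparse el))
      split : ∀ {a b} → a ∈ Q ⊎ a ≡ v → b ∈ Q ⊎ b ≡ v → a ≢ b → b ∉ N a
      split (inj₁ a∈)   (inj₁ b∈)   a≢b = independent a∈ b∈ a≢b
      split (inj₁ a∈)   (inj₂ refl) a≢b = ≢true λ v∈N → true≢false (N-sym v∈N) (separate a∈)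
      split (inj₂ refl) (inj₁ b∈)   a≢b = separate b∈
      split (inj₂ refl) (inj₂ refl) a≢b = contradiction refl a≢b

    first : First L₁
    first = Pass.pass-invariant (suc k) self First first-step record
      { Q           = ∅
      ; size≡       = sym (trans (cong (λ m → count L₀ + m) (count-∅ n)) (+-identityʳ _))
      ; grows       = λ _ → id
      ; Q⊆C         = λ _ ()
      ; Q⊆L         = λ _ ()
      ; fresh       = λ ()
      ; independent = λ ()
      }

    -- Otherwise the first pass would have taken `v` itself. Hence every vertex charged by the later
    -- passes lies in `L₁`.
    covered : ∀ {v} → v ∈ C → v ∉ L₁ → k < count (N v ∩ᵇ L₁)
    covered {v} v∈C v∉L₁ = ≰⇒> λ few →
      Pass.pass-done (suc k) self (λ _ → id) (eligibly v∈C (N-refl v) v∉L₁ (s≤s few) (same-refl v))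

    count-grows : ∀ {L L′} v → L ⊆ L′ → count (N v ∩ᵇ L) ≤ count (N v ∩ᵇ L′)
    count-grows {L} {L′} v L⊆L′ = count-mono _ _ (∩-mono (N v) L L′ L⊆L′)

    -- Adjacent vertices u and v that were both charged by the second or the
    -- third pass form a component of L₁ and have no common neighbour; then
    -- a new neighbour of u is the second leaf of a star at u.
    record Separated (u v : Fin n) : Set where
      field
        no-common : ∀ {m} → m ∈ N u → m ∈ N v → m ≡ u ⊎ m ≡ v
        alone₁    : ∀ {z} → z ∈ L₁ → z ∈ N u → z ≡ u ⊎ z ≡ v
        alone₂    : ∀ {z} → z ∈ L₁ → z ∈ N v → z ≡ u ⊎ z ≡ v
        2≤q       : 2 ≤ q

    Separated-sym : ∀ {u v} → Separated u v → Separated v u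
    Separated-sym S = record
      { no-common = λ a b → swap (no-common b a)
      ; alone₁    = λ a b → swap (alone₂ a b)
      ; alone₂    = λ a b → swap (alone₁ a b)
      ; 2≤q       = 2≤q
      }
      where open Separated S

    -- `M` is the set at the start of the current pass. `pending` anticipates that a neighbour `v`
    -- of a charged vertex may still be charged; it yields `pairs` at the moment when `v` joins `Q`.
    record Later (M L : BSet n) : Set where
      field
        Q       : BSet n
        size≡   : count L ≡ count L₀ + count Q
        grows₁  : L₁ ⊆ L
        grows   : M ⊆ L
        Q⊆C     : Q ⊆ C
        Q⊆L₁    : Q ⊆ L₁
        rich    : ∀ {v} → v ∈ Q → k < count (N v ∩ᵇ L)
        pairs   : ∀ {u v} → u ∈ Q → v ∈ Q → u ≢ v → v ∈ N u → Separated u v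
        pending : ∀ {u v w} → u ∈ Q → v ∈ C → u ≢ v → v ∈ N u → count (N v ∩ᵇ L) ≤ k →
                  w ∈ N v → w ∉ L → Separated u v

    -- Both `pairs` and `pending` hold vacuously: the vertices charged so far are independent, and a
    -- neighbour of one of them has gained that vertex, so it is no longer sparse.
    later-start : Later L₁ L₁
    later-start = record
      { Q       = Q
      ; size≡   = size≡
      ; grows₁  = λ _ → id
      ; grows   = λ _ → id
      ; Q⊆C     = Q⊆C
      ; Q⊆L₁    = Q⊆L
      ; rich    = λ v∈Q → gain grows (Q⊆C _ v∈Q) (N-refl _) (fresh v∈Q) (N-refl _) (Q⊆L _ v∈Q) (fresh v∈Q)
      ; pairs   = λ u∈ v∈ u≢v v∈N → ⊥-elim (true≢false v∈N (independent u∈ v∈ u≢v))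
      ; pending = λ u∈ v∈C u≢v v∈N few w∈N w∉L → ⊥-elim
          (<⇒≱ (gain grows v∈C w∈N (∉-⊆ L₀ L₁ grows w∉L) (N-sym v∈N) (Q⊆L _ u∈) (fresh u∈)) few)
      }
      where open First first

    pair-star : ∀ {m u v} → u ∈ N m → v ∈ N m → u ≢ m → v ≢ m → u ≢ v → v ∉ N u → 2 ≤ q
    pair-star {m} {u} {v} u∈ v∈ u≢m v≢m u≢v v∉ = star f m f-injective f∈ f≢ f-far
      where
      f : Fin 2 → Fin n
      f zero    = u
      f (suc _) = v
      f-injective : Injective _≡_ _≡_ f
      f-injective {zero}     {zero}     p = refl
      f-injective {zero}     {suc zero} p = contradiction p u≢v
      f-injective {suc zero} {zero}     p = contradiction (sym p) u≢v
      f-injective {suc zero} {suc zero} p = refl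
      f∈ : ∀ i → f i ∈ N m
      f∈ zero    = u∈
      f∈ (suc _) = v∈
      f≢ : ∀ i → f i ≢ m
      f≢ zero    = u≢m
      f≢ (suc _) = v≢m
      f-far : ∀ i j → i ≢ j → f j ∉ N (f i)
      f-far zero       zero       i≢j = contradiction refl i≢j
      f-far zero       (suc zero) i≢j = v∉
      f-far (suc zero) zero       i≢j = ≢true λ p → true≢false (N-sym p) v∉
      f-far (suc zero) (suc zero) i≢j = contradiction refl i≢j

    -- What a pass has to guarantee when it charges v for w.
    NoCommon : BSet n → Fin n → Fin n → Set
    NoCommon L v w = ∀ {u m} → (∀ {z} → z ∈ L → z ∈ N v → z ≡ v ⊎ z ≡ u) → u ∈ L → u ∈ N v → u ∉ N w →
                     m ∈ N v → m ∈ N u → m ∉ L → ⊥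

    -- Against earlier charges `v` is handled by `pending`. Conversely, let `b` be a neighbour of
    -- `v` that is still sparse after `w` is added. Then `v` and `b` lie in `L₁` and exhaust what
    -- the sets contain of `N v` and `N b`. A common neighbour outside `L` is excluded by `apart`,
    -- and `w` and `b` are non-adjacent leaves of a star at `v`.
    later-step : ∀ {M L v w} {extra : Extra} → NoCommon L v w →
                 Later M L → Eligible (suc k) extra L v w → Later M (insert w L)
    later-step {M} {L} {v} {w} apart P el = record
      { Q       = insert v Q
      ; size≡   = charge-size L Q v w size≡ w∉L v∉Q
      ; grows₁  = λ u u∈ → L⊆ u (grows₁ u u∈)
      ; grows   = λ u u∈ → L⊆ u (grows u u∈)
      ; Q⊆C     = insert-⊆ v Q C Q⊆C v∈C
      ; Q⊆L₁    = insert-⊆ v Q L₁ Q⊆L₁ v∈L₁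
      ; rich    = λ u∈ → rich′ (insert-cases v Q u∈)
      ; pairs   = λ a∈ b∈ → pairs′ (insert-cases v Q a∈) (insert-cases v Q b∈)
      ; pending = λ a∈ → pending′ (insert-cases v Q a∈)
      }
      where
      open Later P
      v∈C : v ∈ C
      v∈C = isCandidate el
      w∉L : w ∉ L
      w∉L = isNew el
      few : count (N v ∩ᵇ L) ≤ k
      few = s≤s⁻¹ (isSparse el)
      L⊆ : L ⊆ insert w L
      L⊆ = ⊆-insert w L
      v∉Q : v ∉ Q
      v∉Q = ≢true λ v∈Q → <⇒≱ (rich v∈Q) few
      in-L₁ : ∀ {u} → u ∈ C → count (N u ∩ᵇ L) ≤ k → u ∈ L₁
      in-L₁ {u} u∈C few with true? (L₁ u)
      ... | inj₁ u∈L₁ = u∈L₁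
      ... | inj₂ u∉L₁ = contradiction few (<⇒≱ (<-≤-trans (covered u∈C u∉L₁) (count-grows u grows₁)))
      v∈L₁ : v ∈ L₁
      v∈L₁ = in-L₁ v∈C few
      w∉L₀ : w ∉ L₀
      w∉L₀ = ∉-⊆ L₀ L (λ u u∈ → grows₁ u (First.grows first u u∈)) w∉L
      rich′ : ∀ {u} → u ∈ Q ⊎ u ≡ v → k < count (N u ∩ᵇ insert w L)
      rich′ {u} (inj₁ u∈Q) = <-≤-trans (rich u∈Q) (count-grows u L⊆)
      rich′ (inj₂ refl) = gain (λ u u∈ → L⊆ u (grows₁ u (First.grows first u u∈)))
                            v∈C (isClose el) w∉L₀ (isClose el) (∈-insert w L) w∉L₀
      pairs′ : ∀ {a b} → a ∈ Q ⊎ a ≡ v → b ∈ Q ⊎ b ≡ v → a ≢ b → b ∈ N a → Separated a b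
      pairs′ (inj₁ a∈)   (inj₁ b∈)   a≢b b∈N = pairs a∈ b∈ a≢b b∈N
      pairs′ (inj₁ a∈)   (inj₂ refl) a≢b b∈N = pending a∈ v∈C a≢b b∈N few (isClose el) w∉L
      pairs′ (inj₂ refl) (inj₁ b∈)   a≢b b∈N =
        Separated-sym (pending b∈ v∈C (a≢b ∘ sym) (N-sym b∈N) few (isClose el) w∉L)
      pairs′ (inj₂ refl) (inj₂ refl) a≢b b∈N = contradiction refl a≢b
      -- This is where `k ≤ 2` enters: `a` and `b` already use up all the elements that a sparse
      -- neighbourhood may contain.
      only-two : ∀ {a b L z} → a ∈ N a → b ∈ N a → a ∈ L → b ∈ L → a ≢ b → count (N a ∩ᵇ L) ≤ k →
                 z ∈ L → z ∈ N a → z ≡ a ⊎ z ≡ b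
      only-two {a} {b} {L} {z} a∈N b∈N a∈L b∈L a≢b few z∈L z∈N with z ≟ᶠ a | z ≟ᶠ b
      ... | yes z≡a | _       = inj₁ z≡a
      ... | no z≢a  | yes z≡b = inj₂ z≡b
      ... | no z≢a  | no z≢b  = contradiction
        (3≤count (N a ∩ᵇ L) (true-and a∈N a∈L) (true-and b∈N b∈L) (true-and z∈N z∈L) a≢b (z≢a ∘ sym) (z≢b ∘ sym))
        (<⇒≱ (s≤s (≤-trans few k≤2)))
      pending′ : ∀ {a b x} → a ∈ Q ⊎ a ≡ v → b ∈ C → a ≢ b → b ∈ N a → count (N b ∩ᵇ insert w L) ≤ k →
                 x ∈ N b → x ∉ insert w L → Separated a b
      pending′ {b = b} (inj₁ a∈) b∈C a≢b b∈N few′ x∈N x∉ =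
        pending a∈ b∈C a≢b b∈N (≤-trans (count-grows b L⊆) few′) x∈N (∉-⊆ L (insert w L) L⊆ x∉)
      pending′ {b = b} (inj₂ refl) b∈C v≢b b∈N few′ x∈N x∉ = record
        { no-common = no-common
        ; alone₁    = λ z∈ → only-v (grows₁ _ z∈)
        ; alone₂    = λ z∈ z∈N → swap (only-b (L⊆ _ (grows₁ _ z∈)) z∈N)
        ; 2≤q       = pair-star b∈N (isClose el) (v≢b ∘ sym) (∈∉⇒≢ L (grows₁ _ v∈L₁) w∉L ∘ sym)
                        (∈∉⇒≢ L b∈L w∉L) w∉Nb
        }
        where
        b∈L : b ∈ L
        b∈L = grows₁ _ (in-L₁ b∈C (≤-trans (count-grows b L⊆) few′))
        only-v : ∀ {z} → z ∈ L → z ∈ N v → z ≡ v ⊎ z ≡ b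
        only-v = only-two {L = L} (N-refl v) b∈N (grows₁ _ v∈L₁) b∈L v≢b few
        only-b : ∀ {z} → z ∈ insert w L → z ∈ N b → z ≡ b ⊎ z ≡ v
        only-b = only-two {L = insert w L} (N-refl b) (N-sym b∈N) (L⊆ _ b∈L) (L⊆ _ (grows₁ _ v∈L₁))
                          (v≢b ∘ sym) few′
        -- `w` has just entered the set, whose only elements in `N b` are `b` and `v`.
        w∉Nb : w ∉ N b
        w∉Nb = ≢true λ w∈N → [ ∈∉⇒≢ L b∈L w∉L ∘ sym , ∈∉⇒≢ L (grows₁ _ v∈L₁) w∉L ∘ sym ]′
                               (only-b (∈-insert w L) w∈N)
        no-common : ∀ {m} → m ∈ N v → m ∈ N b → m ≡ v ⊎ m ≡ b
        no-common {m} m∈v m∈b with true? (L m)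
        ... | inj₁ m∈L = only-v m∈L m∈v
        ... | inj₂ m∉L = ⊥-elim (apart only-v b∈L b∈N (≢true λ p → true≢false (N-sym p) w∉Nb) m∈v m∈b m∉L)

    -- The second pass takes `w` only if `N w` contains all of `N v ∩ᵇ L`, in particular `u`, so the
    -- situation excluded by `NoCommon` cannot arise.
    later₂ : Later L₁ L₂
    later₂ = Pass.pass-invariant (suc k) central (Later L₁)
      (λ P el → later-step (λ _ u∈L u∈v u∉w _ _ _ → true≢false (central-sound (isExtra el) _ u∈v u∈L) u∉w) P el)
      later-start

    later₂′ : Later L₂ L₂
    later₂′ = record
      { Q = Q ; size≡ = size≡ ; grows₁ = grows₁ ; grows = λ _ → id ; Q⊆C = Q⊆C ; Q⊆L₁ = Q⊆L₁
      ; rich = rich ; pairs = pairs ; pending = pending }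
      where open Later later₂

    -- If `u` and `v` exhaust `N v ∩ᵇ L`, a common neighbour `m` outside `L` would be a central
    -- choice for `v` at the end of the second pass, which leaves no such choice.
    later₃ : Later L₂ L₃
    later₃ = Pass.pass-invariant (suc k) any (Later L₂)
      (λ {L} P el → later-step (apart P el) P el) later₂′
      where
      apart : ∀ {L v w} → Later L₂ L → Eligible (suc k) any L v w → NoCommon L v w
      apart {L} {v} P el {u} {m} only u∈L u∈v u∉w m∈v m∈u m∉L =
        Pass.pass-done (suc k) central central-antitone
          (eligibly (isCandidate el) m∈v (∉-⊆ L₂ L (Later.grows P) m∉L)
            (≤-<-trans (count-grows v (Later.grows P)) (isSparse el))
            (central-complete λ z z∈v z∈L₂ → near (only (Later.grows P z z∈L₂) z∈v)))
        where
        near : ∀ {z} → z ≡ v ⊎ z ≡ u → z ∈ N m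
        near (inj₁ refl) = N-sym m∈v
        near (inj₂ refl) = N-sym m∈u

    saturated₃ : Saturated (suc k) L₃
    saturated₃ {v} v∈C with any? (λ w → (N v w Bool.≟ true) ×-dec (L₃ w Bool.≟ false))
    ... | yes (w , w∈N , w∉L₃) = inj₂ (≰⇒> λ few →
            Pass.pass-done (suc k) any (λ _ → id) (eligibly v∈C w∈N w∉L₃ (s≤s few) refl))
    ... | no none = inj₁ λ w w∈N → [ id , (λ w∉ → contradiction (w , w∈N , w∉) none) ]′ (true? (L₃ w))

    charged : BSet n
    charged = Later.Q later₃

    charged-size : count L₃ ≡ count L₀ + count charged
    charged-size = Later.size≡ later₃

    charged-⊆ : charged ⊆ C
    charged-⊆ = Later.Q⊆C later₃

    1≤q : ∀ {v} → v ∈ C → 1 ≤ q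
    1≤q {v} v∈C with u , u∈N , u≢v ← nonisolated v∈C =
      star {1} (λ _ → u) v (λ { {zero} {zero} _ → refl }) (λ _ → u∈N) (λ _ → u≢v)
        (λ { zero zero i≢j → contradiction refl i≢j })

    -- If `N m` contains adjacent charged vertices `u` and `v`, then `m` is one of them because they
    -- have no other common neighbour, and nothing else in `N m` is charged since they are alone in
    -- `L₁`. Otherwise the charged vertices in `N m` are independent: they are the leaves of a star
    -- at `m`, or `m` is charged and is the only one.
    charged-spread : ∀ m → count (N m ∩ᵇ charged) ≤ q
    charged-spread m with any? (λ u → any? (λ v →
      ((N m ∩ᵇ Q) u Bool.≟ true) ×-dec ((N m ∩ᵇ Q) v Bool.≟ true) ×-dec ¬? (u ≟ᶠ v) ×-dec (N u v Bool.≟ true)))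
      where open Later later₃
    ... | yes (u , v , u∈ , v∈ , u≢v , v∈N)
        with u∈m , u∈Q ← and-true u∈
        with v∈m , v∈Q ← and-true v∈
        = ≤-trans (count≤2 (N m ∩ᵇ Q) u v only) 2≤q
      where
      open Later later₃
      open Separated (pairs u∈Q v∈Q u≢v v∈N)
      only : ∀ z → z ∈ N m ∩ᵇ Q → z ≡ u ⊎ z ≡ v
      only z z∈ with z∈m , z∈Q ← and-true z∈ with no-common (N-sym u∈m) (N-sym v∈m)
      ... | inj₁ refl = alone₁ (Q⊆L₁ z z∈Q) z∈m
      ... | inj₂ refl = alone₂ (Q⊆L₁ z z∈Q) z∈m
    ... | no none with true? (charged m)
    ...   | inj₂ m∉Q = star (proj₁ list) m (proj₁ (proj₂ list)) (λ i → proj₁ (and-true (member i)))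
                         (λ i → λ p → ∈∉⇒≢ charged (proj₂ (and-true {N m _} (member i))) m∉Q p)
                         (λ i j i≢j → ≢true λ p → none (_ , _ , member i , member j ,
                                                          (λ e → i≢j (proj₁ (proj₂ list) e)) , p))
      where
      list = enumerate (N m ∩ᵇ charged)
      member = proj₂ (proj₂ list)
    ...   | inj₁ m∈Q = ≤-trans (≤-trans (count-mono (N m ∩ᵇ charged) (insert m ∅) only) (count-insert-≤ ∅ m))
                               (subst (λ c → suc c ≤ q) (sym (count-∅ n)) (1≤q (charged-⊆ m m∈Q)))
      where
      only : N m ∩ᵇ charged ⊆ insert m ∅
      only z z∈ with z ≟ᶠ m
      ... | yes refl = ∈-insert m ∅
      ... | no z≢m   = contradiction
        (m , z , true-and (N-refl m) m∈Q , z∈ , z≢m ∘ sym , proj₁ (and-true z∈)) none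

-- Weights and the potential

Σℤ : ∀ {n} → (Fin n → ℤ) → ℤ
Σℤ {zero}  f = ℤ.0ℤ
Σℤ {suc n} f = f zero ℤ.+ Σℤ (f ∘ suc)

only : Bool → ℤ → ℤ
only b z = ifᵇ b then z else ℤ.0ℤ

weight : ∀ {n} → BSet n → (Fin n → ℤ) → ℤ
weight A X = Σℤ (λ u → only (A u) (X u))

infixr 6 _⊕_

_⊕_ : ∀ {a b} → ℤ.0ℤ ℤ.≤ a → ℤ.0ℤ ℤ.≤ b → ℤ.0ℤ ℤ.≤ a ℤ.+ b
_⊕_ = ℤ.+-mono-≤

slack : ∀ {a b} → a ℤ.≤ b → ℤ.0ℤ ℤ.≤ b ℤ.- a
slack = ℤ.i≤j⇒0≤j-i

-- Inequalities are proved by writing `b - a` as a sum of nonnegative terms; the ring solver checks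
-- the identity.
unslack : ∀ {a b c} → c ≡ b ℤ.- a → ℤ.0ℤ ℤ.≤ c → a ℤ.≤ b
unslack refl = ℤ.0≤i-j⇒j≤i

Σ-mono : ∀ {n} {f g : Fin n → ℤ} → (∀ u → f u ℤ.≤ g u) → Σℤ f ℤ.≤ Σℤ g
Σ-mono {zero}  f≤g = ℤ.≤-refl
Σ-mono {suc n} f≤g = ℤ.+-mono-≤ (f≤g zero) (Σ-mono (f≤g ∘ suc))

Σ-cong : ∀ {n} {f g : Fin n → ℤ} → (∀ u → f u ≡ g u) → Σℤ f ≡ Σℤ g
Σ-cong {zero}  f≡g = refl
Σ-cong {suc n} f≡g = cong₂ ℤ._+_ (f≡g zero) (Σ-cong (f≡g ∘ suc))

Σ-nonneg : ∀ {n} {f : Fin n → ℤ} → (∀ u → ℤ.0ℤ ℤ.≤ f u) → ℤ.0ℤ ℤ.≤ Σℤ f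
Σ-nonneg {zero}  0≤f = ℤ.≤-refl
Σ-nonneg {suc n} 0≤f = 0≤f zero ⊕ Σ-nonneg (0≤f ∘ suc)

Σ-zero : ∀ n → Σℤ {n} (λ _ → ℤ.0ℤ) ≡ ℤ.0ℤ
Σ-zero zero    = refl
Σ-zero (suc n) = trans (ℤ.+-identityˡ _) (Σ-zero n)

Σ-+ : ∀ {n} (f g : Fin n → ℤ) → Σℤ (λ u → f u ℤ.+ g u) ≡ Σℤ f ℤ.+ Σℤ g
Σ-+ {zero}  f g = refl
Σ-+ {suc n} f g = trans (cong (λ r → f zero ℤ.+ g zero ℤ.+ r) (Σ-+ (f ∘ suc) (g ∘ suc)))
                        (interchange (f zero) (g zero) _ _)
  where
  interchange : ∀ a b c d → (a ℤ.+ b) ℤ.+ (c ℤ.+ d) ≡ (a ℤ.+ c) ℤ.+ (b ℤ.+ d)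
  interchange = ℤ-Solver.solve-∀

Σ-*ˡ : ∀ {n} c (f : Fin n → ℤ) → Σℤ (λ u → c ℤ.* f u) ≡ c ℤ.* Σℤ f
Σ-*ˡ {zero}  c f = sym (ℤ.*-zeroʳ c)
Σ-*ˡ {suc n} c f = trans (cong (λ r → c ℤ.* f zero ℤ.+ r) (Σ-*ˡ c (f ∘ suc))) (sym (ℤ.*-distribˡ-+ c _ _))

Σ-swap : ∀ {m n} (f : Fin m → Fin n → ℤ) → Σℤ (λ i → Σℤ (f i)) ≡ Σℤ (λ j → Σℤ (λ i → f i j))
Σ-swap {zero}  {n} f = sym (Σ-zero n)
Σ-swap {suc m} f = trans (cong (λ r → Σℤ (f zero) ℤ.+ r) (Σ-swap (f ∘ suc)))
                         (sym (Σ-+ (f zero) (λ j → Σℤ (λ i → f (suc i) j))))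

Σ-const : ∀ {n} (A : BSet n) c → weight A (λ _ → c) ≡ c ℤ.* + count A
Σ-const {zero}  A c = sym (ℤ.*-zeroʳ c)
Σ-const {suc n} A c with A zero
... | false = trans (ℤ.+-identityˡ _) (Σ-const (A ∘ suc) c)
... | true  = trans (cong (λ r → c ℤ.+ r) (Σ-const (A ∘ suc) c)) (regroup c (+ count (A ∘ suc)))
  where
  regroup : ∀ c m → c ℤ.+ c ℤ.* m ≡ c ℤ.* (ℤ.1ℤ ℤ.+ m)
  regroup = ℤ-Solver.solve-∀

count≤n : ∀ {n} (A : BSet n) → count A ≤ n
count≤n {zero}  A = z≤n
count≤n {suc n} A = +-mono-≤ (bit≤1 (A zero)) (count≤n (A ∘ suc))
  where
  bit≤1 : ∀ b → toBit b ≤ 1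
  bit≤1 true  = ≤-refl
  bit≤1 false = z≤n

bump : ∀ {n} → ℤ → BSet n → (Fin n → ℤ) → Fin n → ℤ
bump δ A X u = ifᵇ A u then δ ℤ.+ X u else X u

weight-bump : ∀ {n} δ (A B : BSet n) X →
              weight B (bump δ A X) ≡ weight B X ℤ.+ δ ℤ.* + count (B ∩ᵇ A)
weight-bump {zero}  δ A B X = sym (trans (ℤ.+-identityˡ _) (ℤ.*-zeroʳ δ))
weight-bump {suc n} δ A B X =
  trans (cong (λ r → only (B zero) (bump δ A X zero) ℤ.+ r) (weight-bump δ (A ∘ suc) (B ∘ suc) (X ∘ suc)))
        (head-step (B zero) (A zero) (X zero) (weight (B ∘ suc) (X ∘ suc)) (count ((B ∩ᵇ A) ∘ suc)))
  where
  head-step : ∀ b a x w c →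
    only b (ifᵇ a then δ ℤ.+ x else x) ℤ.+ (w ℤ.+ δ ℤ.* + c) ≡
    (only b x ℤ.+ w) ℤ.+ δ ℤ.* + (toBit (b and a) + c)
  head-step false a     x w c = sym (ℤ.+-assoc ℤ.0ℤ w (δ ℤ.* + c))
  head-step true  false x w c = sym (ℤ.+-assoc x w (δ ℤ.* + c))
  head-step true  true  x w c = regroup δ x w (+ c)
    where
    regroup : ∀ δ z w c → (δ ℤ.+ z) ℤ.+ (w ℤ.+ δ ℤ.* c) ≡ (z ℤ.+ w) ℤ.+ δ ℤ.* (ℤ.1ℤ ℤ.+ c)
    regroup = ℤ-Solver.solve-∀

Σ-bump : ∀ {n} δ (A : BSet n) X → Σℤ (bump δ A X) ≡ Σℤ X ℤ.+ δ ℤ.* + count A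
Σ-bump δ A X = weight-bump δ A (λ _ → true) X

square : ℤ → ℤ
square z = z ℤ.* z

-- The squared distance from X to d times the indicator of M.
potential : ∀ {n} → ℤ → BSet n → (Fin n → ℤ) → ℤ
potential d M X = Σℤ (λ u → square (X u ℤ.- only (M u) d))

-- Each element of `A` contributes twice `δ` times its difference from the target, plus the square
-- of `δ`, which is one.
potential-bump :
  ∀ {n} d (M : BSet n) δ (A : BSet n) X → δ ℤ.* δ ≡ ℤ.1ℤ →
  potential d M (bump δ A X) ≡
  potential d M X ℤ.+ (+ 2 ℤ.* (δ ℤ.* (weight A X ℤ.- d ℤ.* + count (A ∩ᵇ M))) ℤ.+ + count A)
potential-bump {zero}  d M δ A X δ² = base d δ
  where
  base : ∀ d δ → ℤ.0ℤ ≡ ℤ.0ℤ ℤ.+ (+ 2 ℤ.* (δ ℤ.* (ℤ.0ℤ ℤ.- d ℤ.* ℤ.0ℤ)) ℤ.+ ℤ.0ℤ)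
  base = ℤ-Solver.solve-∀
potential-bump {suc n} d M δ A X δ² =
  trans (cong (λ r → square (bump δ A X zero ℤ.- only (M zero) d) ℤ.+ r)
              (potential-bump d (M ∘ suc) δ (A ∘ suc) (X ∘ suc) δ²))
        (head-step (A zero) (M zero) (X zero) (potential d (M ∘ suc) (X ∘ suc))
                   (weight (A ∘ suc) (X ∘ suc)) (count ((A ∩ᵇ M) ∘ suc)) (count (A ∘ suc)))
  where
  head-step : ∀ a m x p w c e →
    square ((ifᵇ a then δ ℤ.+ x else x) ℤ.- only m d)
      ℤ.+ (p ℤ.+ (+ 2 ℤ.* (δ ℤ.* (w ℤ.- d ℤ.* + c)) ℤ.+ + e)) ≡
    (square (x ℤ.- only m d) ℤ.+ p)
      ℤ.+ (+ 2 ℤ.* (δ ℤ.* ((only a x ℤ.+ w) ℤ.- d ℤ.* + (toBit (a and m) + c))) ℤ.+ + (toBit a + e))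
  head-step false m x p w c e = outside d δ (square (x ℤ.- only m d)) p w (+ c) (+ e)
    where
    outside : ∀ d δ h p w c e →
      h ℤ.+ (p ℤ.+ (+ 2 ℤ.* (δ ℤ.* (w ℤ.- d ℤ.* c)) ℤ.+ e)) ≡
      (h ℤ.+ p) ℤ.+ (+ 2 ℤ.* (δ ℤ.* ((ℤ.0ℤ ℤ.+ w) ℤ.- d ℤ.* c)) ℤ.+ e)
    outside = ℤ-Solver.solve-∀
  head-step true m x p w c e =
    trans (inside δ x (only m d) p w (d ℤ.* + c) (+ e))
          (cong₂ (λ i l → (square (x ℤ.- only m d) ℤ.+ p)
                           ℤ.+ (+ 2 ℤ.* (δ ℤ.* ((x ℤ.+ w) ℤ.- l)) ℤ.+ (i ℤ.+ + e)))
                 δ² (target m))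
    where
    inside : ∀ δ x l p w c e →
      (δ ℤ.+ x ℤ.- l) ℤ.* (δ ℤ.+ x ℤ.- l) ℤ.+ (p ℤ.+ (+ 2 ℤ.* (δ ℤ.* (w ℤ.- c)) ℤ.+ e)) ≡
      ((x ℤ.- l) ℤ.* (x ℤ.- l) ℤ.+ p) ℤ.+
        (+ 2 ℤ.* (δ ℤ.* ((x ℤ.+ w) ℤ.- (l ℤ.+ c))) ℤ.+ (δ ℤ.* δ ℤ.+ e))
    inside = ℤ-Solver.solve-∀
    target : ∀ m → only m d ℤ.+ d ℤ.* + c ≡ d ℤ.* + (toBit m + c)
    target false = ℤ.+-identityˡ _
    target true  = sym (ℤ.*-suc d (+ c))

square-nonneg : ∀ z → ℤ.0ℤ ℤ.≤ square z
square-nonneg (+ m)     = subst (ℤ.0ℤ ℤ.≤_) (ℤ.pos-* m m) (ℤ.+≤+ z≤n)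
square-nonneg -[1+ m ]  = ℤ.+≤+ z≤n

potential-nonneg : ∀ {n} d (M : BSet n) X → ℤ.0ℤ ℤ.≤ potential d M X
potential-nonneg d M X = Σ-nonneg (λ u → square-nonneg (X u ℤ.- only (M u) d))

-- Disjunctions and repeated rounds as loops

for-or : ∀ {n} (A : BSet n) {z} → for (λ u a → A u or a) z ≡ true → (∃[ u ] u ∈ A) ⊎ z ≡ true
for-or {zero}  A p = inj₂ p
for-or {suc n} A p with or-true {A zero} p
... | inj₁ q = inj₁ (zero , q)
... | inj₂ q with for-or (A ∘ suc) q
...   | inj₁ (u , u∈A) = inj₁ (suc u , u∈A)
...   | inj₂ r         = inj₂ r

or-for : ∀ {n} (A : BSet n) {z} u → u ∈ A → for (λ u a → A u or a) z ≡ true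
or-for A zero    p = true-orˡ p
or-for A (suc u) p = true-orʳ {A zero} (or-for (A ∘ suc) u p)

or-for-init : ∀ {n} (A : BSet n) {z} → z ≡ true → for (λ u a → A u or a) z ≡ true
or-for-init A = for-invariant (_≡ true) (λ u p → true-orʳ {A u} p)

repeated-rounds : ∀ {S : Set} (n : ℕ) → ℕ → (S → S) → S → S
repeated-rounds n zero    f s = f s
repeated-rounds n (suc k) f s = for {n = n} (λ _ → repeated-rounds n k f) s

-- `P` is indexed by the number of rounds completed, so the conclusion also counts the rounds.
repeated-invariant : ∀ {S : Set} {f : S → S} (P : ℕ → S → Set) → (∀ {r s} → P r s → P (suc r) (f s)) →
                     ∀ n k {r s} → P r s → P (n ^ k + r) (repeated-rounds n k f s)
repeated-invariant {f = f} P step n zero    p = step p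
repeated-invariant {f = f} P step n (suc k) p = outer n p
  where
  outer : ∀ m {r s} → P r s → P (m * n ^ k + r) (for {n = m} (λ _ → repeated-rounds n k f) s)
  outer zero    p = p
  outer (suc m) {r} {s} p =
    subst (λ l → P l (for {n = suc m} (λ _ → repeated-rounds n k f) s)) (sym (+-assoc (n ^ k) (m * n ^ k) r))
          (repeated-invariant P step n k (outer m p))

if-elim : ∀ {S : Set} (P : S → Set) b {c d} → (b ≡ true → P c) → (b ≡ false → P d) →
          P (ifᵇ b then c else d)
if-elim P true  t f = t refl
if-elim P false t f = f refl

-- The perceptron

State : ℕ → Set
State n = (Fin n → ℤ) × (Fin n → ℤ) × ℤ × BSet n

module _ {n : ℕ} where

  X-of D-of : State n → Fin n → ℤ
  X-of (X , _ , _ , _) = X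
  D-of (_ , D , _ , _) = D

  gap-of : State n → ℤ
  gap-of (_ , _ , g , _) = g

  R-of : State n → BSet n
  R-of (_ , _ , _ , R) = R

  -- The total of the recorded weighting, or the fictitious initial bound. It changes only when
  -- something is recorded.
  total : State n → ℤ
  total st = gap-of st ℤ.+ Σℤ (X-of st)

module Perceptron {n : ℕ} (N E : Fin n → BSet n) (threshold bound : ℕ) where

  shift : ℤ → ℤ → BSet n → State n → State n
  shift δ δ′ A st =
      bump δ A (X-of st)
    , (λ v → for (λ u a → ifᵇ (N v ∩ᵇ A) u then δ′ ℤ.+ a else a) (D-of st v))
    , for (λ u a → ifᵇ A u then δ′ ℤ.+ a else a) (gap-of st)
    , R-of st

  short : Fin n → State n → Bool
  short x st = isPositive (D-of st x)

  violated : Fin n → Fin n → State n → Bool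
  violated x y st = E x y and short x st and short y st

  anyViolated : State n → Bool
  anyViolated st = for (λ x a → for (λ y a′ → violated x y st or a′) a) false

  raise : Fin n → Fin n → State n → State n
  raise x y st = shift ℤ.1ℤ ℤ.-1ℤ (N y) (shift ℤ.1ℤ ℤ.-1ℤ (N x) st)

  sweepPair : Fin n → Fin n → State n → State n
  sweepPair x y st = ifᵇ violated x y st then raise x y st else st

  sweepFrom : Fin n → State n → State n
  sweepFrom x st = for (sweepPair x) st

  sweep : State n → State n
  sweep st = for sweepFrom st

  keep : State n → State n
  keep st = ifᵇ isPositive (gap-of st)
            then (X-of st , D-of st , ℤ.0ℤ , λ v → neg (short v st)) else st

  support : State n → BSet n
  support st u = isPositive (X-of st u)

  round : State n → State n
  round st = ifᵇ anyViolated st then sweep st else shift ℤ.-1ℤ ℤ.1ℤ (support (keep st)) (keep st)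

  -- The state keeps the total and the vertex set of the recorded weighting but not the weighting
  -- itself; `certificate` carries it as the witness `Y`. Its first alternative says that the total
  -- is still the initial bound.
  record Valid (st : State n) : Set where
    field
      nonneg      : ∀ u → ℤ.0ℤ ℤ.≤ X-of st u
      deficits    : ∀ v → D-of st v ≡ + threshold ℤ.- weight (N v) (X-of st)
      cover       : ∀ {x y} → y ∈ E x → x ∈ R-of st ⊎ y ∈ R-of st
      certificate : total st ≡ + bound ⊎
                    (∃[ Y ] (∀ u → ℤ.0ℤ ℤ.≤ Y u) × Σℤ Y ≡ total st ×
                            (∀ {v} → v ∈ R-of st → + threshold ℤ.≤ weight (N v) Y))

  total-shift : ∀ δ A st → total (shift δ (ℤ.- δ) A st) ≡ total st
  total-shift δ A st =
    trans (cong₂ ℤ._+_ (for-add A (ℤ.- δ) (gap-of st)) (Σ-bump δ A (X-of st)))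
          (regroup δ (gap-of st) (Σℤ (X-of st)) (+ count A))
    where
    regroup : ∀ δ g w c → (g ℤ.+ ℤ.- δ ℤ.* c) ℤ.+ (w ℤ.+ δ ℤ.* c) ≡ g ℤ.+ w
    regroup = ℤ-Solver.solve-∀

  shift-valid : ∀ δ A {st} → (∀ u → ℤ.0ℤ ℤ.≤ bump δ A (X-of st) u) → Valid st →
                Valid (shift δ (ℤ.- δ) A st)
  shift-valid δ A {st} nonneg′ V = record
    { nonneg      = nonneg′
    ; deficits    = λ v → trans (for-add (N v ∩ᵇ A) (ℤ.- δ) (D-of st v))
                      (trans (cong₂ (λ z w → z ℤ.+ w) (deficits v) refl)
                        (trans (regroup δ (+ threshold) (weight (N v) (X-of st)) (+ count (N v ∩ᵇ A)))
                          (cong (λ w → + threshold ℤ.- w) (sym (weight-bump δ A (N v) (X-of st))))))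
    ; cover       = cover
    ; certificate = subst (λ W → W ≡ + bound ⊎ (∃[ Y ] (∀ u → ℤ.0ℤ ℤ.≤ Y u) × Σℤ Y ≡ W ×
                             (∀ {v} → v ∈ R-of st → + threshold ℤ.≤ weight (N v) Y)))
                          (sym (total-shift δ A st)) certificate
    }
    where
    open Valid V
    regroup : ∀ δ t w c → (t ℤ.- w) ℤ.+ ℤ.- δ ℤ.* c ≡ t ℤ.- (w ℤ.+ δ ℤ.* c)
    regroup = ℤ-Solver.solve-∀

  inc-nonneg : ∀ A {X : Fin n → ℤ} → (∀ u → ℤ.0ℤ ℤ.≤ X u) → ∀ u → ℤ.0ℤ ℤ.≤ bump ℤ.1ℤ A X u
  inc-nonneg A 0≤X u with A u
  ... | true  = ℤ.+≤+ z≤n ⊕ 0≤X u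
  ... | false = 0≤X u

  raise-valid : ∀ {x y st} → Valid st → Valid (raise x y st)
  raise-valid {x} {y} V =
    shift-valid ℤ.1ℤ (N y) (inc-nonneg (N y) (Valid.nonneg V′)) V′
    where V′ = shift-valid ℤ.1ℤ (N x) (inc-nonneg (N x) (Valid.nonneg V)) V

  raise-total : ∀ x y st → total (raise x y st) ≡ total st
  raise-total x y st = trans (total-shift ℤ.1ℤ (N y) (shift ℤ.1ℤ ℤ.-1ℤ (N x) st)) (total-shift ℤ.1ℤ (N x) st)

  violated-sound : ∀ {x y st} → violated x y st ≡ true → Valid st →
                   y ∈ E x × weight (N x) (X-of st) ℤ.< + threshold × weight (N y) (X-of st) ℤ.< + threshold
  violated-sound {x} {y} {st} p V
    with e , p ← and-true {E x y} p
    with l , r ← and-true {short x st} p = e , light x l , light y r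
    where
    light : ∀ v → short v st ≡ true → weight (N v) (X-of st) ℤ.< + threshold
    light v l = 0<a-b⇒b<a (subst (ℤ.0ℤ ℤ.<_) (Valid.deficits V v) (isPositive-sound l))

  anyViolated-sound : ∀ {st} → anyViolated st ≡ true → ∃[ x ] ∃[ y ] violated x y st ≡ true
  anyViolated-sound {st} p = for-invariant Found found (λ ()) p
    where
    Found : Bool → Set
    Found a = a ≡ true → ∃[ x ] ∃[ y ] violated x y st ≡ true
    found : ∀ x {a} → Found a → Found (for (λ y a′ → violated x y st or a′) a)
    found x f e with for-or (λ y → violated x y st) e
    ... | inj₁ (y , v) = x , y , v
    ... | inj₂ q       = f q

  anyViolated-complete : ∀ {st} → anyViolated st ≡ false → ∀ x y → violated x y st ≡ false
  anyViolated-complete {st} p x y = ≢true λ v → true≢false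
    (for-reach (λ _ → ⊤) (_≡ true) _ (λ x′ _ → or-for-init (λ y → violated x′ y st)) x
       (λ _ → or-for (λ y → violated x y st) y v) tt) p

  -- An edge with both ends outside the new set would have two short ends and be violated. The new
  -- witness is the current weighting.
  keep-valid : ∀ {st} → (∀ x y → violated x y st ≡ false) → Valid st → Valid (keep st)
  keep-valid {st} none V with isPositive (gap-of st)
  ... | false = V
  ... | true  = record
    { nonneg      = nonneg
    ; deficits    = deficits
    ; cover       = λ {x} {y} e → covering e (true? (short x st)) (true? (short y st))
    ; certificate = inj₂ (X-of st , nonneg , sym (ℤ.+-identityˡ _) , λ {v} → heavy)
    }
    where
    open Valid V
    covering : ∀ {x y} → y ∈ E x → short x st ≡ true ⊎ short x st ≡ false →
               short y st ≡ true ⊎ short y st ≡ false → neg (short x st) ≡ true ⊎ neg (short y st) ≡ true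
    covering e (inj₂ p) _        = inj₁ (true-neg p)
    covering e (inj₁ _) (inj₂ p) = inj₂ (true-neg p)
    covering {x} {y} e (inj₁ p) (inj₁ q) = ⊥-elim (true≢false (true-and e (true-and p q)) (none x y))
    heavy : ∀ {v} → neg (short v st) ≡ true → + threshold ℤ.≤ weight (N v) (X-of st)
    heavy {v} p = ℤ.≮⇒≥ λ w<t → true≢false
      (isPositive-complete (subst (ℤ.0ℤ ℤ.<_) (sym (deficits v)) (b<a⇒0<a-b w<t))) (neg-true p)

  keep-X : ∀ st → X-of (keep st) ≡ X-of st
  keep-X st with isPositive (gap-of st)
  ... | true  = refl
  ... | false = refl

  not-positive : ∀ {z} → isPositive z ≡ false → z ℤ.≤ ℤ.0ℤ
  not-positive p = ℤ.≮⇒≥ λ 0<z → true≢false (isPositive-complete 0<z) p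

  keep-total : ∀ st → total (keep st) ℤ.≤ total st × total (keep st) ℤ.≤ Σℤ (X-of st)
  keep-total st with isPositive (gap-of st) in eq
  ... | true  = ℤ.+-monoˡ-≤ (Σℤ (X-of st)) (ℤ.<⇒≤ (isPositive-sound eq)) , ℤ.≤-reflexive (ℤ.+-identityˡ _)
  ... | false = ℤ.≤-refl ,
    ℤ.≤-trans (ℤ.+-monoˡ-≤ (Σℤ (X-of st)) (not-positive eq)) (ℤ.≤-reflexive (ℤ.+-identityˡ _))

  dec-nonneg : ∀ {X : Fin n → ℤ} → (∀ u → ℤ.0ℤ ℤ.≤ X u) →
               ∀ u → ℤ.0ℤ ℤ.≤ bump ℤ.-1ℤ (λ u → isPositive (X u)) X u
  dec-nonneg {X} 0≤X u with isPositive (X u) in eq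
  ... | true  = subst (ℤ.0ℤ ℤ.≤_) (ℤ.+-comm (X u) ℤ.-1ℤ) (slack (ℤ.i<j⇒suc[i]≤j (isPositive-sound eq)))
  ... | false = 0≤X u

  weight-support : ∀ {X : Fin n → ℤ} → (∀ u → ℤ.0ℤ ℤ.≤ X u) → weight (λ u → isPositive (X u)) X ≡ Σℤ X
  weight-support {X} 0≤X = Σ-cong same-term
    where
    same-term : ∀ u → only (isPositive (X u)) (X u) ≡ X u
    same-term u with isPositive (X u) in eq
    ... | true  = refl
    ... | false = ℤ.≤-antisym (0≤X u) (not-positive eq)

  -- Raising a violated edge and lowering a heavy weighting both move X closer to
  -- d times the indicator of M.
  module Progress (M : BSet n)
    (meets : ∀ {x y} → y ∈ E x → 2 ≤ count (N x ∩ᵇ M) + count (N y ∩ᵇ M)) where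

    -- Raising a violated edge lowers the potential through the linear terms, with total weight `2d`
    -- at least twice over, and adds at most `4n` in the remaining terms. The surplus `n` over the
    -- threshold pays exactly for these.
    d : ℤ
    d = + threshold ℤ.+ + n

    Φ : State n → ℤ
    Φ st = potential d M (X-of st)

    raise-drop : ∀ {x y st} → Valid st → violated x y st ≡ true → Φ (raise x y st) ℤ.+ ℤ.1ℤ ℤ.≤ Φ st
    raise-drop {x} {y} {st} V p with e , wx< , wy< ← violated-sound {st = st} p V =
      unslack (trans (certify (Φ st) (+ threshold) (+ n) (weight (N x) (X-of st)) (weight (N y) (X-of st))
                              (+ count (N x ∩ᵇ M)) (+ count (N y ∩ᵇ M)) (+ count (N y ∩ᵇ N x))
                              (+ count (N x)) (+ count (N y)))
                     (cong (λ l → Φ st ℤ.- (l ℤ.+ ℤ.1ℤ)) (sym Φ-raise)))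
        (ℤ.+≤+ z≤n ⊕ twice (slack (ℤ.i<j⇒suc[i]≤j wx<)) ⊕ twice (slack (ℤ.i<j⇒suc[i]≤j wy<))
         ⊕ twice (few (N y ∩ᵇ N x)) ⊕ few (N x) ⊕ few (N y) ⊕ twice hits)
      where
      twice : ∀ {z} → ℤ.0ℤ ℤ.≤ z → ℤ.0ℤ ℤ.≤ + 2 ℤ.* z
      twice {z} p = subst (ℤ.0ℤ ℤ.≤_) (double z) (p ⊕ p)
        where
        double : ∀ z → z ℤ.+ z ≡ + 2 ℤ.* z
        double = ℤ-Solver.solve-∀
      few : ∀ A → ℤ.0ℤ ℤ.≤ + n ℤ.- + count A
      few A = slack (ℤ.+≤+ (count≤n A))
      hits : ℤ.0ℤ ℤ.≤ d ℤ.* (+ count (N x ∩ᵇ M) ℤ.+ + count (N y ∩ᵇ M)) ℤ.- d ℤ.* + 2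
      hits = slack (ℤ.*-monoˡ-≤-nonNeg d (ℤ.+≤+ (meets e)))
      Φ-raise : Φ (raise x y st) ≡
        (Φ st ℤ.+ (+ 2 ℤ.* (ℤ.1ℤ ℤ.* (weight (N x) (X-of st) ℤ.- d ℤ.* + count (N x ∩ᵇ M))) ℤ.+ + count (N x)))
        ℤ.+ (+ 2 ℤ.* (ℤ.1ℤ ℤ.* ((weight (N y) (X-of st) ℤ.+ ℤ.1ℤ ℤ.* + count (N y ∩ᵇ N x))
                                 ℤ.- d ℤ.* + count (N y ∩ᵇ M))) ℤ.+ + count (N y))
      Φ-raise = trans (potential-bump d M ℤ.1ℤ (N y) (bump ℤ.1ℤ (N x) (X-of st)) refl)
        (cong₂ (λ p w → p ℤ.+ (+ 2 ℤ.* (ℤ.1ℤ ℤ.* (w ℤ.- d ℤ.* + count (N y ∩ᵇ M))) ℤ.+ + count (N y)))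
               (potential-bump d M ℤ.1ℤ (N x) (X-of st) refl)
               (weight-bump ℤ.1ℤ (N x) (N y) (X-of st)))
      certify : ∀ p t n wx wy cx cy e f g →
        + 3 ℤ.+ (+ 2 ℤ.* (t ℤ.- (ℤ.1ℤ ℤ.+ wx)) ℤ.+ (+ 2 ℤ.* (t ℤ.- (ℤ.1ℤ ℤ.+ wy))
        ℤ.+ (+ 2 ℤ.* (n ℤ.- e) ℤ.+ ((n ℤ.- f) ℤ.+ ((n ℤ.- g)
        ℤ.+ + 2 ℤ.* ((t ℤ.+ n) ℤ.* (cx ℤ.+ cy) ℤ.- (t ℤ.+ n) ℤ.* + 2)))))) ≡
        p ℤ.- (((p ℤ.+ (+ 2 ℤ.* (ℤ.1ℤ ℤ.* (wx ℤ.- (t ℤ.+ n) ℤ.* cx)) ℤ.+ f))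
        ℤ.+ (+ 2 ℤ.* (ℤ.1ℤ ℤ.* ((wy ℤ.+ ℤ.1ℤ ℤ.* e) ℤ.- (t ℤ.+ n) ℤ.* cy)) ℤ.+ g)) ℤ.+ ℤ.1ℤ)
      certify = ℤ-Solver.solve-∀

    limit : ℤ
    limit = d ℤ.* + count M ℤ.+ + n

    -- Lowering moves towards the target because the weight on the support is all of `Σℤ X`, while
    -- the target has at most `d * count M` there. The remainder `n` in `limit` covers the squares
    -- of the unit steps.
    lower-drop : ∀ {st} → Valid st → limit ℤ.< Σℤ (X-of st) →
                 Φ (shift ℤ.-1ℤ ℤ.1ℤ (support st) st) ℤ.+ ℤ.1ℤ ℤ.≤ Φ st
    lower-drop {st} V heavy =
      unslack (trans (certify (Φ st) d (+ n) (Σℤ (X-of st)) (+ count (support st ∩ᵇ M)) (+ count M)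
                              (+ count (support st)))
                     (cong (λ l → Φ st ℤ.- (l ℤ.+ ℤ.1ℤ)) (sym Φ-lower)))
        -- Here the drop is at least `n + 2`, which leaves `1 + n`.
        (ℤ.+≤+ (z≤n {1 + n}) ⊕ h₁ ⊕ h₁ ⊕ slack (ℤ.+≤+ (count≤n (support st))) ⊕ h₂ ⊕ h₂)
      where
      h₁ = slack (ℤ.i<j⇒suc[i]≤j heavy)
      h₂ = slack (ℤ.*-monoˡ-≤-nonNeg d (ℤ.+≤+ (count-mono (support st ∩ᵇ M) M (λ v p → proj₂ (and-true p)))))
      Φ-lower : Φ (shift ℤ.-1ℤ ℤ.1ℤ (support st) st) ≡
        Φ st ℤ.+ (+ 2 ℤ.* (ℤ.-1ℤ ℤ.* (Σℤ (X-of st) ℤ.- d ℤ.* + count (support st ∩ᵇ M))) ℤ.+ + count (support st))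
      Φ-lower = trans (potential-bump d M ℤ.-1ℤ (support st) (X-of st) refl)
        (cong (λ w → Φ st ℤ.+ (+ 2 ℤ.* (ℤ.-1ℤ ℤ.* (w ℤ.- d ℤ.* + count (support st ∩ᵇ M))) ℤ.+ + count (support st)))
              (weight-support (Valid.nonneg V)))
      certify : ∀ p d n w c m a →
        (ℤ.1ℤ ℤ.+ n) ℤ.+ ((w ℤ.- (ℤ.1ℤ ℤ.+ (d ℤ.* m ℤ.+ n))) ℤ.+ ((w ℤ.- (ℤ.1ℤ ℤ.+ (d ℤ.* m ℤ.+ n)))
        ℤ.+ ((n ℤ.- a) ℤ.+ ((d ℤ.* m ℤ.- d ℤ.* c) ℤ.+ (d ℤ.* m ℤ.- d ℤ.* c))))) ≡
        p ℤ.- ((p ℤ.+ (+ 2 ℤ.* (ℤ.-1ℤ ℤ.* (w ℤ.- d ℤ.* c)) ℤ.+ a)) ℤ.+ ℤ.1ℤ)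
      certify = ℤ-Solver.solve-∀

    Good : State n → Set
    Good st = total st ℤ.≤ limit

    record Dropped (st₀ st : State n) : Set where
      constructor dropped
      field
        drop≤ : Φ st ℤ.+ ℤ.1ℤ ℤ.≤ Φ st₀

    Dropped-trans : ∀ {st₀ st₁ st₂} → Dropped st₀ st₁ → Dropped st₁ st₂ → Dropped st₀ st₂
    Dropped-trans (dropped p) (dropped q) = dropped (ℤ.≤-trans q (ℤ.≤-trans (ℤ.i≤i+j _ ℤ.1ℤ) p))

    record Swept (st₀ st : State n) : Set where
      field
        valid  : Valid st
        total≡ : total st ≡ total st₀
        change : st ≡ st₀ ⊎ Dropped st₀ st

    drop-after : ∀ {st₀ st st′} → st ≡ st₀ ⊎ Dropped st₀ st → Dropped st st′ → Dropped st₀ st′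
    drop-after (inj₁ refl) q = q
    drop-after (inj₂ p)    q = Dropped-trans p q

    raise-swept : ∀ {x y st₀ st} → Swept st₀ st → violated x y st ≡ true → Swept st₀ (raise x y st)
    raise-swept {x} {y} {st₀} {st} S p = record
      { valid  = raise-valid (Swept.valid S)
      ; total≡ = trans (raise-total x y st) (Swept.total≡ S)
      ; change = inj₂ (drop-after (Swept.change S) (dropped (raise-drop (Swept.valid S) p)))
      }

    sweepPair-swept : ∀ {x y st₀ st} → Swept st₀ st → Swept st₀ (sweepPair x y st)
    sweepPair-swept {x} {y} {st₀} {st} S =
      if-elim (Swept st₀) (violated x y st) (raise-swept S) (λ _ → S)

    sweepPair-dropped : ∀ {x y st₀ st} → Swept st₀ st → Dropped st₀ st → Dropped st₀ (sweepPair x y st)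
    sweepPair-dropped {x} {y} {st₀} {st} S D =
      if-elim (Dropped st₀) (violated x y st)
        (λ p → Dropped-trans D (dropped (raise-drop (Swept.valid S) p))) (λ _ → D)

    -- Earlier raises in the sweep may have repaired this edge, but then the potential has already
    -- dropped. Otherwise the state is unchanged and the edge is raised now. This is why `change` in
    -- `Swept` distinguishes the two cases.
    sweepPair-hit : ∀ {x y st₀ st} → violated x y st₀ ≡ true → Swept st₀ st → Dropped st₀ (sweepPair x y st)
    sweepPair-hit {x} {y} {st₀} {st} p S = by-change (Swept.change S)
      where
      by-change : st ≡ st₀ ⊎ Dropped st₀ st → Dropped st₀ (sweepPair x y st)
      by-change (inj₂ D)    = sweepPair-dropped S D
      by-change (inj₁ refl) = if-elim (Dropped st₀) (violated x y st₀)
        (λ q → dropped (raise-drop (Swept.valid S) q)) (λ q → ⊥-elim (true≢false p q))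

    sweepFrom-swept : ∀ x {st₀ st} → Swept st₀ st → Swept st₀ (sweepFrom x st)
    sweepFrom-swept x {st₀} = for-invariant {f = sweepPair x} (Swept st₀) (λ _ → sweepPair-swept)

    sweepFrom-dropped : ∀ x {st₀ st} → Swept st₀ st → Dropped st₀ st → Dropped st₀ (sweepFrom x st)
    sweepFrom-dropped x {st₀} S D = proj₂ (for-invariant {f = sweepPair x}
      (λ st → Swept st₀ st × Dropped st₀ st)
      (λ _ (S , D) → sweepPair-swept S , sweepPair-dropped S D) (S , D))

    sweep-swept : ∀ {st} → Valid st → Swept st (sweep st)
    sweep-swept {st} V = for-invariant {f = sweepFrom} (Swept st) (λ x′ → sweepFrom-swept x′)
      (record { valid = V ; total≡ = refl ; change = inj₁ refl })

    sweep-dropped : ∀ {st x y} → Valid st → violated x y st ≡ true → Dropped st (sweep st)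
    sweep-dropped {st} {x} {y} V p =
      for-reach {f = sweepFrom} (Swept st) (Dropped st) (λ x′ → sweepFrom-swept x′) (λ x′ → sweepFrom-dropped x′) x
        (for-reach {f = sweepPair x} (Swept st) (Dropped st) (λ _ → sweepPair-swept)
          (λ _ → sweepPair-dropped) y (sweepPair-hit p))
        (record { valid = V ; total≡ = refl ; change = inj₁ refl })

    -- Once good, a state stays good since `total` never grows. Until then each round lowers the
    -- potential by at least one.
    record Progressed (Φ₀ : ℤ) (r : ℕ) (st : State n) : Set where
      constructor progressed
      field
        valid  : Valid st
        status : Good st ⊎ Φ st ℤ.+ + r ℤ.≤ Φ₀

    advance : ∀ {Φ₀ r st st′} → Dropped st st′ → Φ st ℤ.+ + r ℤ.≤ Φ₀ → Φ st′ ℤ.+ + suc r ℤ.≤ Φ₀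
    advance {r = r} {st′ = st′} (dropped drop) bound =
      ℤ.≤-trans (ℤ.≤-reflexive (sym (ℤ.+-assoc (Φ st′) ℤ.1ℤ (+ r)))) (ℤ.≤-trans (ℤ.+-monoˡ-≤ (+ r) drop) bound)

    lower : State n → State n
    lower st = shift ℤ.-1ℤ ℤ.1ℤ (support st) st

    sweep-progress : ∀ {Φ₀ r st x y} → Progressed Φ₀ r st → violated x y st ≡ true →
                     Progressed Φ₀ (suc r) (sweep st)
    sweep-progress {r = r} (progressed V status) p = progressed (Swept.valid S)
      (Sum.map (ℤ.≤-trans (ℤ.≤-reflexive (Swept.total≡ S))) (advance {r = r} (sweep-dropped V p)) status)
      where S = sweep-swept V

    keep-dropped : ∀ {st} → Valid (keep st) → ¬ (Σℤ (X-of st) ℤ.≤ limit) → Dropped st (lower (keep st))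
    keep-dropped {st} V heavy = dropped
      (subst (λ X → Φ (lower (keep st)) ℤ.+ ℤ.1ℤ ℤ.≤ potential d M X) (keep-X st)
        (lower-drop V (subst (λ X → limit ℤ.< Σℤ X) (sym (keep-X st)) (ℤ.≰⇒> heavy))))

    -- If the current weighting is within `limit`, the recorded total is at most that after `keep`,
    -- so the state becomes good. If it is heavier, lowering it reduces the potential.
    lower-progress : ∀ {Φ₀ r st} → Progressed Φ₀ r st → anyViolated st ≡ false →
                     Progressed Φ₀ (suc r) (lower (keep st))
    lower-progress {Φ₀} {r} {st} (progressed V status) none =
      progressed (shift-valid ℤ.-1ℤ (support (keep st)) (dec-nonneg (Valid.nonneg V′)) V′)
                 (settle (Σℤ (X-of st) ℤ.≤? limit))
      where
      V′ : Valid (keep st)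
      V′ = keep-valid (anyViolated-complete {st} none) V
      good : total (keep st) ℤ.≤ limit → Good (lower (keep st))
      good = ℤ.≤-trans (ℤ.≤-reflexive (total-shift ℤ.-1ℤ (support (keep st)) (keep st)))
      settle : Dec (Σℤ (X-of st) ℤ.≤ limit) →
               Good (lower (keep st)) ⊎ Φ (lower (keep st)) ℤ.+ + suc r ℤ.≤ Φ₀
      settle (yes light) = inj₁ (good (ℤ.≤-trans (proj₂ (keep-total st)) light))
      settle (no heavy)  = Sum.map (λ g → good (ℤ.≤-trans (proj₁ (keep-total st)) g))
                                   (advance {r = r} {st = st} (keep-dropped V′ heavy)) status

    round-progress : ∀ {Φ₀ r st} → Progressed Φ₀ r st → Progressed Φ₀ (suc r) (round st)
    round-progress {Φ₀} {r} {st} P = if-elim (Progressed Φ₀ (suc r)) (anyViolated st)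
      (λ e → sweep-progress P (proj₂ (proj₂ (anyViolated-sound {st} e)))) (lower-progress P)

-- The run of the algorithm on a graph

for-cong : ∀ {S : Set} {n} {f g : Fin n → S → S} → (∀ i a → f i a ≡ g i a) → ∀ a → for f a ≡ for g a
for-cong {n = zero}              p a = refl
for-cong {n = suc n} {g = g} p a = trans (p zero _) (cong (g zero) (for-cong (λ i → p (suc i)) a))

repeatᵗ-rounds : ∀ {τ n} k (t : Term (τ ∷ Matᵗ ∷ Matᵗ ∷ []) τ) (a : ⟦ τ ⟧ n) N E →
                 ⟦ repeatᵗ k t ⟧ᵗ (a , N , E , tt) ≡
                 repeated-rounds n k (λ b → ⟦ t ⟧ᵗ (b , N , E , tt)) a
repeatᵗ-rounds zero    t a N E = refl
repeatᵗ-rounds {n = n} (suc k) t a N E = for-cong {n = n} (λ _ b → repeatᵗ-rounds k t b N E) a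

module Run {n : ℕ} (E : Fin n → BSet n) where

  closed : Fin n → BSet n
  closed v w = E v w or same v w

  nonisolated : BSet n
  nonisolated v = for (λ u a → E v u or a) false

  iterated-suc : ℕ → ℤ
  iterated-suc k = repeated-rounds n k ℤ.suc ℤ.0ℤ

  iterated-suc-value : ∀ k → iterated-suc k ≡ + (n ^ k)
  iterated-suc-value k =
    trans (repeated-invariant (λ r z → z ≡ + r) (cong ℤ.suc) n k {0} refl) (cong +_ (+-identityʳ (n ^ k)))

  initial : ℕ → ℕ → State n
  initial a b = (λ _ → ℤ.0ℤ) , (λ _ → iterated-suc a) , iterated-suc b , λ _ → true

  layer : ℕ → BSet n → BSet n → BSet n
  layer k C L = pass k any (pass k central (pass k self L))
    where open Passes closed C

  layers : BSet n → BSet n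
  layers C = layer 3 C (layer 2 C (layer 1 C ∅))

  module Weights (a b c : ℕ) where
    open Perceptron closed E (n ^ a) (n ^ b) public

    final : State n
    final = repeated-rounds n c round (initial a b)

    candidates : BSet n
    candidates v = R-of final v and nonisolated v

  -- Only the loops whose nesting depth is a variable exponent need rewriting; everything else
  -- agrees by computation.
  liarᵗ-spec : ∀ a b c → ⟦ liarᵗ a b c ⟧ᵗ (E , tt) ≡ layers (Weights.candidates a b c)
  liarᵗ-spec a b c
    rewrite repeatᵗ-rounds a (app inc (var v0)) ℤ.0ℤ closed E
          | repeatᵗ-rounds b (app inc (var v0)) ℤ.0ℤ closed E
          | repeatᵗ-rounds c roundᵗ (initial a b) closed E = refl

  -- The three inequalities: the rounds outnumber the largest initial potential; the fictitious
  -- initial total exceeds every `limit`, so something has been recorded; the threshold is so large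
  -- that the additive errors vanish by integrality.
  module Bounds (a b c q : ℕ) (N-refl : ∀ v → v ∈ closed v) (N-sym : ∀ {u v} → v ∈ closed u → u ∈ closed v)
    (enough-rounds : (n ^ a + n) * (n ^ a + n) * n < n ^ c)
    (large-bound : (n ^ a + n) * n + n < n ^ b)
    (large-threshold : q * (n * n + n) < n ^ a)
    where

    open Weights a b c

    threshold : ℕ
    threshold = n ^ a

    initial-valid : Valid (initial a b)
    initial-valid = record
      { nonneg      = λ _ → ℤ.≤-refl
      ; deficits    = λ v → trans (iterated-suc-value a) (sym (trans
                        (cong (λ w → + threshold ℤ.- w) (Σ-const (closed v) ℤ.0ℤ)) (ℤ.+-identityʳ _)))
      ; cover       = λ _ → inj₁ refl
      ; certificate = inj₁ (trans (cong₂ ℤ._+_ (iterated-suc-value b) (Σ-zero n)) (ℤ.+-identityʳ _))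
      }

    module _ (M : BSet n)
      (meets : ∀ {x y} → y ∈ E x → 2 ≤ count (closed x ∩ᵇ M) + count (closed y ∩ᵇ M)) where
      open Progress M meets

      final-progress : Progressed (Φ (initial a b)) (n ^ c + 0) final
      final-progress = repeated-invariant (Progressed (Φ (initial a b))) round-progress n c
        (progressed initial-valid (inj₂ (ℤ.≤-reflexive (ℤ.+-identityʳ _))))

      initial-potential : Φ (initial a b) ≡ + ((threshold + n) * (threshold + n) * count M)
      initial-potential = trans (Σ-cong {g = λ u → only (M u) (d ℤ.* d)} λ u → square-only (M u))
        (trans (Σ-const M (d ℤ.* d))
          (trans (cong (λ z → z ℤ.* + count M) (sym (ℤ.pos-* (threshold + n) (threshold + n))))
                 (sym (ℤ.pos-* ((threshold + n) * (threshold + n)) (count M)))))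
        where
        square-only : ∀ m → square (ℤ.0ℤ ℤ.- only m d) ≡ only m (d ℤ.* d)
        square-only false = refl
        square-only true  = negate d
          where
          negate : ∀ d → (ℤ.0ℤ ℤ.- d) ℤ.* (ℤ.0ℤ ℤ.- d) ≡ d ℤ.* d
          negate = ℤ-Solver.solve-∀

      not-enough : ¬ (Φ final ℤ.+ + (n ^ c + 0) ℤ.≤ Φ (initial a b))
      not-enough p = <⇒≱ enough-rounds (≤-trans
        (≤-trans (≤-reflexive (sym (+-identityʳ (n ^ c))))
          (ℤ.drop‿+≤+ (subst (λ z → + (n ^ c + 0) ℤ.≤ z) initial-potential
            (ℤ.≤-trans (ℤ.≤-trans (ℤ.≤-reflexive (sym (ℤ.+-identityˡ _)))
                                  (ℤ.+-monoˡ-≤ (+ (n ^ c + 0)) (potential-nonneg d M (X-of final)))) p))))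
        (*-monoʳ-≤ ((threshold + n) * (threshold + n)) (count≤n M)))

      final-good : Good final
      final-good = [ id , (λ p → contradiction p not-enough) ]′ (Progressed.status final-progress)

      limit-value : limit ≡ + ((threshold + n) * count M + n)
      limit-value = cong (λ z → z ℤ.+ + n) (sym (ℤ.pos-* (threshold + n) (count M)))

      Certificate : Set
      Certificate = ∃[ Y ] (∀ u → ℤ.0ℤ ℤ.≤ Y u) × Σℤ Y ℤ.≤ limit ×
                    (∀ {v} → v ∈ R-of final → + threshold ℤ.≤ weight (closed v) Y)

      bound-large : ¬ (+ (n ^ b) ℤ.≤ limit)
      bound-large p = <⇒≱ (≤-<-trans (+-monoˡ-≤ n (*-monoʳ-≤ (threshold + n) (count≤n M))) large-bound)
        (ℤ.drop‿+≤+ (subst (λ z → + (n ^ b) ℤ.≤ z) limit-value p))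

      certified : Certificate
      certified = certify (Valid.certificate (Progressed.valid final-progress))
        where
        certify : total final ≡ + (n ^ b) ⊎
                  (∃[ Y ] (∀ u → ℤ.0ℤ ℤ.≤ Y u) × Σℤ Y ≡ total final ×
                          (∀ {v} → v ∈ R-of final → + threshold ℤ.≤ weight (closed v) Y)) → Certificate
        certify (inj₁ total≡) = ⊥-elim (bound-large (subst (λ z → z ℤ.≤ limit) total≡ final-good))
        certify (inj₂ (Y , 0≤Y , ΣY , heavy)) =
          Y , 0≤Y , subst (λ z → z ℤ.≤ limit) (sym ΣY) final-good , heavy

      -- Double counting: every vertex of `Q` sees weight at least `threshold`, and each `Y u` is
      -- seen by at most `q` vertices of `Q`.
      spread-weight : ∀ Q → Q ⊆ R-of final → (∀ m → count (closed m ∩ᵇ Q) ≤ q) →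
                      Certificate → + threshold ℤ.* + count Q ℤ.≤ + q ℤ.* limit
      spread-weight Q Q⊆R spread (Y , 0≤Y , ΣY≤ , heavy) = begin
        + threshold ℤ.* + count Q                              ≡⟨ Σ-const Q (+ threshold) ⟨
        weight Q (λ _ → + threshold)                           ≤⟨ Σ-mono (λ v → only-mono (Q v) (λ v∈Q → heavy (Q⊆R v v∈Q))) ⟩
        weight Q (λ v → weight (closed v) Y)                   ≡⟨ Σ-cong (λ v → only-Σ (Q v) _) ⟩
        Σℤ (λ v → Σℤ (λ u → only (Q v) (only (closed v u) (Y u)))) ≡⟨ Σ-swap (λ v u → only (Q v) (only (closed v u) (Y u))) ⟩
        Σℤ (λ u → Σℤ (λ v → only (Q v) (only (closed v u) (Y u))))
          ≡⟨ Σ-cong (λ u → trans (Σ-cong (λ v → flip v u (Q v) refl)) (Σ-const (closed u ∩ᵇ Q) (Y u))) ⟩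
        Σℤ (λ u → Y u ℤ.* + count (closed u ∩ᵇ Q))
          ≤⟨ Σ-mono (λ u → ℤ.≤-trans (ℤ.*-monoˡ-≤-nonNeg (Y u) {{ℤ.nonNegative (0≤Y u)}} (ℤ.+≤+ (spread u)))
                                      (ℤ.≤-reflexive (ℤ.*-comm (Y u) (+ q)))) ⟩
        Σℤ (λ u → + q ℤ.* Y u)                                 ≡⟨ Σ-*ˡ (+ q) Y ⟩
        + q ℤ.* Σℤ Y                                           ≤⟨ ℤ.*-monoˡ-≤-nonNeg (+ q) ΣY≤ ⟩
        + q ℤ.* limit                                          ∎
        where
        open ℤ.≤-Reasoning
        only-mono : ∀ b {y z} → (b ≡ true → y ℤ.≤ z) → only b y ℤ.≤ only b z
        only-mono true  p = p refl
        only-mono false p = ℤ.≤-refl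
        only-Σ : ∀ b (f : Fin n → ℤ) → only b (Σℤ f) ≡ Σℤ (λ u → only b (f u))
        only-Σ true  f = refl
        only-Σ false f = sym (Σ-zero n)
        closed-sym : ∀ u v → closed u v ≡ closed v u
        closed-sym u v with true? (closed u v)
        ... | inj₁ p = trans p (sym (N-sym p))
        ... | inj₂ p = trans p (sym (≢true (λ r → true≢false (N-sym r) p)))
        flip : ∀ v u b → Q v ≡ b → only (Q v) (only (closed v u) (Y u)) ≡ only ((closed u ∩ᵇ Q) v) (Y u)
        flip v u b eq rewrite closed-sym u v | eq with closed v u | b
        ... | true  | true  = refl
        ... | true  | false = refl
        ... | false | true  = refl
        ... | false | false = refl

      -- If `count Q` exceeded `q * count M` by one or more, the weighted bound would leave
      -- `threshold ≤ q * (n * count M + n)`, contrary to the choice of the threshold.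
      spread-bound : ∀ Q → Q ⊆ R-of final → (∀ m → count (closed m ∩ᵇ Q) ≤ q) → count Q ≤ q * count M
      spread-bound Q Q⊆R spread = ≮⇒≥ λ big → <⇒≱ large-threshold (begin
        threshold                                                     ≡⟨ m+n∸n≡m threshold (threshold * (q * m)) ⟨
        threshold + threshold * (q * m) ∸ threshold * (q * m)         ≡⟨ cong (_∸ threshold * (q * m)) (*-suc threshold (q * m)) ⟨
        threshold * suc (q * m) ∸ threshold * (q * m)
          ≤⟨ ∸-monoˡ-≤ (threshold * (q * m)) (≤-trans (*-monoʳ-≤ threshold big) weighted) ⟩
        q * ((threshold + n) * m + n) ∸ threshold * (q * m)           ≡⟨ cong (_∸ threshold * (q * m)) (expand q threshold n m) ⟩
        q * (n * m + n) + threshold * (q * m) ∸ threshold * (q * m)   ≡⟨ m+n∸n≡m (q * (n * m + n)) (threshold * (q * m)) ⟩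
        q * (n * m + n)                                               ≤⟨ *-monoʳ-≤ q (+-monoˡ-≤ n (*-monoʳ-≤ n (count≤n M))) ⟩
        q * (n * n + n)                                               ∎)
        where
        open ≤-Reasoning
        m = count M
        weighted : threshold * count Q ≤ q * ((threshold + n) * m + n)
        weighted = ℤ.drop‿+≤+ (subst₂ ℤ._≤_ (sym (ℤ.pos-* threshold (count Q)))
          (trans (cong (λ z → + q ℤ.* z) limit-value) (sym (ℤ.pos-* q ((threshold + n) * m + n))))
          (spread-weight Q Q⊆R spread certified))
        expand : ∀ q t n m → q * ((t + n) * m + n) ≡ q * (n * m + n) + t * (q * m)
        expand = ℕ-Solver.solve-∀

    0<count : ∀ (A : BSet n) {v} → v ∈ A → 0 < count A
    0<count A v∈A = ≤-<-trans z≤n (count-strict ∅ A (λ _ ()) v∈A refl)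

    final-cover : ∀ {x y} → y ∈ E x → x ∈ R-of final ⊎ y ∈ R-of final
    -- The invariant of the run is stated relative to a feasible set; the set of all vertices is
    -- one.
    final-cover = Valid.cover (Progress.Progressed.valid (final-progress full meets-full))
      where
      full : BSet n
      full _ = true
      meets-full : ∀ {x y} → y ∈ E x → 2 ≤ count (closed x ∩ᵇ full) + count (closed y ∩ᵇ full)
      meets-full {x} {y} _ = +-mono-≤ (0<count (closed x ∩ᵇ full) {x} (true-and (N-refl x) refl))
                                      (0<count (closed y ∩ᵇ full) {y} (true-and (N-refl y) refl))

-- Powers of `n` that meet the three requirements

module _ where
  open ≤-Reasoning

  n<2^n : ∀ n → n < 2 ^ n
  n<2^n zero    = s≤s z≤n
  n<2^n (suc n) = begin-strict
    1 + n           <⟨ +-mono-≤-< (m^n>0 2 n) (n<2^n n) ⟩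
    2 ^ n + 2 ^ n   ≡⟨ cong (λ m → 2 ^ n + m) (+-identityʳ (2 ^ n)) ⟨
    2 ^ suc n       ∎

  double-≤ : ∀ {n} → 2 ≤ n → ∀ m → m + m ≤ n * m
  double-≤ {n} 2≤n m = begin
    m + m         ≡⟨ cong (λ l → m + l) (+-identityʳ m) ⟨
    2 * m         ≤⟨ *-monoˡ-≤ m 2≤n ⟩
    n * m         ∎

  pow-step : ∀ {n} → 2 ≤ n → ∀ k → n ^ k < n ^ suc k
  pow-step {n} 2≤n k = ^-monoʳ-< n 2≤n (n<1+n k)

  square+n : ∀ {n} → 2 ≤ n → n * n + n ≤ n ^ 3
  square+n {n} 2≤n = begin
    n * n + n       ≤⟨ +-monoʳ-≤ (n * n) (≤-trans (m≤m+n n n) (double-≤ 2≤n n)) ⟩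
    n * n + n * n   ≤⟨ double-≤ 2≤n (n * n) ⟩
    n * (n * n)     ≡⟨ cong (λ m → n * (n * m)) (*-identityʳ n) ⟨
    n ^ 3           ∎

  -- The factor `n ^ p` exceeds `p`, and `n ^ 3` takes care of `n * n + n`.
  threshold-large : ∀ {n p q} → 2 ≤ n → q ≤ p → q * (n * n + n) < n ^ (3 + p)
  threshold-large {n} {p} {q} 2≤n q≤p = begin-strict
    q * (n * n + n) ≤⟨ *-mono-≤ q≤p (square+n 2≤n) ⟩
    p * n ^ 3       <⟨ *-monoˡ-< (n ^ 3) {{>-nonZero (m^n>0 n {{>-nonZero (<-trans (s≤s z≤n) 2≤n)}} 3)}}
                        (<-≤-trans (n<2^n p) (^-monoˡ-≤ p 2≤n)) ⟩
    n ^ p * n ^ 3   ≡⟨ *-comm (n ^ p) (n ^ 3) ⟩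
    n ^ 3 * n ^ p   ≡⟨ ^-distribˡ-+-* n 3 p ⟨
    n ^ (3 + p)     ∎

  scale-bound : ∀ {n} → 2 ≤ n → ∀ a → n ^ suc a + n ≤ n ^ suc (suc a)
  scale-bound {n} 2≤n a = begin
    n ^ suc a + n           ≡⟨ cong (λ m → n ^ suc a + m) (*-identityʳ n) ⟨
    n ^ suc a + n ^ 1
      ≤⟨ +-monoʳ-≤ (n ^ suc a) (^-monoʳ-≤ n {{>-nonZero (<-trans (s≤s z≤n) 2≤n)}} (s≤s (z≤n {a}))) ⟩
    n ^ suc a + n ^ suc a   ≤⟨ double-≤ 2≤n (n ^ suc a) ⟩
    n ^ suc (suc a)         ∎

  bound-large : ∀ {n} → 2 ≤ n → ∀ a → (n ^ suc a + n) * n + n < n ^ (5 + a)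
  bound-large {n} 2≤n a = begin-strict
    (n ^ suc a + n) * n + n   ≤⟨ +-monoˡ-≤ n (*-monoˡ-≤ n (scale-bound 2≤n a)) ⟩
    n ^ (2 + a) * n + n       ≡⟨ cong (λ m → m + n) (*-comm (n ^ (2 + a)) n) ⟩
    n ^ (3 + a) + n           ≤⟨ scale-bound 2≤n (2 + a) ⟩
    n ^ (4 + a)               <⟨ pow-step 2≤n (4 + a) ⟩
    n ^ (5 + a)               ∎

  rounds-enough : ∀ {n} → 2 ≤ n → ∀ a →
                  (n ^ suc a + n) * (n ^ suc a + n) * n < n ^ (2 + ((2 + a) + (2 + a)))
  rounds-enough {n} 2≤n a = begin-strict
    (n ^ suc a + n) * (n ^ suc a + n) * n   ≤⟨ *-monoˡ-≤ n (*-mono-≤ (scale-bound 2≤n a) (scale-bound 2≤n a)) ⟩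
    n ^ (2 + a) * n ^ (2 + a) * n           ≡⟨ cong (_* n) (^-distribˡ-+-* n (2 + a) (2 + a)) ⟨
    n ^ ((2 + a) + (2 + a)) * n             ≡⟨ *-comm (n ^ ((2 + a) + (2 + a))) n ⟩
    n ^ (1 + ((2 + a) + (2 + a)))           <⟨ pow-step 2≤n (1 + ((2 + a) + (2 + a))) ⟩
    n ^ (2 + ((2 + a) + (2 + a)))           ∎

-- Boolean sets and subsets

count-lookup : ∀ {n} (P : Subset n) → ∣ P ∣ ≡ count (lookup P)
count-lookup []            = refl
count-lookup (true ∷ P)  = cong suc (count-lookup P)
count-lookup (false ∷ P) = count-lookup P

count≤∣∣ : ∀ {n} (A : BSet n) P → (∀ v → v ∈ A → v ∈ˢ P) → count A ≤ ∣ P ∣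
count≤∣∣ A P A⊆P = ≤-trans (count-mono A (lookup P) (λ v v∈A → []=⇒lookup (A⊆P v v∈A)))
                           (≤-reflexive (sym (count-lookup P)))

∣∣≤count : ∀ {n} (A : BSet n) P → (∀ v → v ∈ˢ P → v ∈ A) → ∣ P ∣ ≤ count A
∣∣≤count A P P⊆A = ≤-trans (≤-reflexive (count-lookup P))
                           (count-mono (lookup P) A (λ v v∈P → P⊆A v (lookup⇒[]= v P v∈P)))

tabulate-∈ : ∀ {n} {A : BSet n} {v} → v ∈ A → v ∈ˢ tabulate A
tabulate-∈ {A = A} {v} v∈A = lookup⇒[]= v (tabulate A) (trans (lookup∘tabulate A v) v∈A)

∈-tabulate : ∀ {n} {A : BSet n} {v} → v ∈ˢ tabulate A → v ∈ A
∈-tabulate {A = A} {v} v∈ = trans (sym (lookup∘tabulate A v)) ([]=⇒lookup v∈)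

count-or : ∀ {n} (A B : BSet n) → count (λ v → A v or B v) ≤ count A + count B
count-or {zero}  A B = z≤n
count-or {suc n} A B = ≤-trans (+-mono-≤ (bits (A zero) (B zero)) (count-or (A ∘ suc) (B ∘ suc)))
                               (≤-reflexive (regroup (toBit (A zero)) (toBit (B zero)) _ _))
  where
  bits : ∀ a b → toBit (a or b) ≤ toBit a + toBit b
  bits false b = ≤-refl
  bits true  b = s≤s z≤n
  regroup : ∀ a b c d → (a + b) + (c + d) ≡ (a + c) + (b + d)
  regroup = ℕ-Solver.solve-∀

2≤count : ∀ {n} (A : BSet n) {a b} → a ∈ A → b ∈ A → a ≢ b → 2 ≤ count A
2≤count {n} A {a} {b} a∈ b∈ a≢b = begin
  2                         ≡⟨ cong (λ m → suc (suc m)) (count-∅ n) ⟨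
  suc (suc (count {n} ∅))   ≡⟨ cong suc (count-insert ∅ b refl) ⟨
  suc (count (insert b ∅))  ≡⟨ count-insert (insert b ∅) a (∉-insert b ∅ refl a≢b) ⟨
  count (insert a (insert b ∅))
    ≤⟨ count-mono _ A (insert-⊆ a (insert b ∅) A (insert-⊆ b ∅ A (λ _ ()) b∈) a∈) ⟩
  count A                   ∎
  where open ≤-Reasoning

-- Stars, edges and liar's ve-dominating sets in the graph

module OnGraph {n : ℕ} (G : Graph n) where
  open Run (adj G)

  N-refl : ∀ v → v ∈ closed v
  N-refl v = true-orʳ {adj G v v} (same-refl v)

  closed-cases : ∀ {u v} → v ∈ closed u → adj G u v ≡ true ⊎ u ≡ v
  closed-cases {u} {v} p = Sum.map₂ same-≡ (or-true {adj G u v} p)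

  closed-adj : ∀ {u v} → adj G u v ≡ true → v ∈ closed u
  closed-adj p = true-orˡ p

  N-sym : ∀ {u v} → v ∈ closed u → u ∈ closed v
  N-sym {u} {v} p with closed-cases p
  ... | inj₁ q    = closed-adj (trans (adj-sym G v u) q)
  ... | inj₂ refl = N-refl u

  adj-≢ : ∀ {u v} → adj G u v ≡ true → u ≢ v
  adj-≢ p refl = true≢false p (no-loop G _)

  nonisolated-neighbour : ∀ {v} → v ∈ nonisolated → ∃[ u ] u ∈ closed v × u ≢ v
  nonisolated-neighbour {v} p with for-or (adj G v) p
  ... | inj₁ (u , q) = u , closed-adj q , adj-≢ q ∘ sym

  adj-nonisolated : ∀ {u v} → adj G u v ≡ true → u ∈ nonisolated
  adj-nonisolated {u} {v} p = or-for (adj G u) v p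

  -- Any `p` leaves of a larger star, together with its centre, induce a claw.
  star-bound : ∀ {p} → ClawFree p G → ∀ {l} (f : Fin l → Fin n) m → Injective _≡_ _≡_ f →
               (∀ i → f i ∈ closed m) → (∀ i → f i ≢ m) →
               (∀ i j → i ≢ j → f j ∉ closed (f i)) → l ≤ p ∸ 1
  star-bound {p} free {l} f m f-injective f∈ f≢ far = ≮⇒≥ λ big → free (claw-at (p≤l p big))
    where
    p≤l : ∀ p → p ∸ 1 < l → p ≤ l
    p≤l zero    _ = z≤n
    p≤l (suc p) q = q
    claw-at : p ≤ l → HasInduced (claw p) G
    claw-at p≤l = g , g-injective , g-adj
      where
      leaf : Fin p → Fin n
      leaf i = f (inject≤ i p≤l)
      g : Fin (suc p) → Fin n
      g zero    = m
      g (suc i) = leaf i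
      g-injective : Injective _≡_ _≡_ g
      g-injective {zero}  {zero}  e = refl
      g-injective {zero}  {suc j} e = contradiction (sym e) (f≢ _)
      g-injective {suc i} {zero}  e = contradiction e (f≢ _)
      g-injective {suc i} {suc j} e = cong suc (inject≤-injective p≤l p≤l i j (f-injective e))
      centre : ∀ i → adj G m (leaf i) ≡ true
      centre i with closed-cases (f∈ (inject≤ i p≤l))
      ... | inj₁ q = q
      ... | inj₂ e = contradiction (sym e) (f≢ _)
      g-adj : ∀ i j → adj G (g i) (g j) ≡ adj (claw p) i j
      g-adj zero    zero    = no-loop G m
      g-adj zero    (suc j) = centre j
      g-adj (suc i) zero    = trans (adj-sym G (leaf i) m) (centre i)
      g-adj (suc i) (suc j) with i ≟ᶠ j
      ... | yes refl = no-loop G (leaf i)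
      ... | no i≢j   = ≢true λ q → true≢false (closed-adj q)
                         (far _ _ (λ e → i≢j (inject≤-injective p≤l p≤l i j e)))

  ∈N⇒closed : ∀ {v u} → u ∈ˢ N[ G ] v → u ∈ closed v
  ∈N⇒closed {v} {u} p with x∈p∪q⁻ (N⟨ G ⟩ v) ⁅ v ⁆ p
  ... | inj₁ q = closed-adj (∈-tabulate q)
  ... | inj₂ q with refl ← x∈⁅y⁆⇒x≡y v q = N-refl v

  closed⇒∈N : ∀ {v u} → u ∈ closed v → u ∈ˢ N[ G ] v
  closed⇒∈N {v} p with closed-cases p
  ... | inj₁ q    = x∈p∪q⁺ (inj₁ (tabulate-∈ q))
  ... | inj₂ refl = x∈p∪q⁺ {p = N⟨ G ⟩ v} (inj₂ (x∈⁅x⁆ v))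

  -- Feasibility of `M` for the linear program: by condition (i) the union of the two neighbourhoods
  -- meets `M` twice, and the sum counts common elements again.
  edge-meets : ∀ {M} → IsLiarVEDominating G M → ∀ {x y} → adj G x y ≡ true →
               2 ≤ count (closed x ∩ᵇ lookup M) + count (closed y ∩ᵇ lookup M)
  edge-meets {M} (twice , _) {x} {y} p =
    ≤-trans (twice e) (≤-trans (∣∣≤count (λ v → (closed x ∩ᵇ lookup M) v or (closed y ∩ᵇ lookup M) v) _ split)
                               (count-or (closed x ∩ᵇ lookup M) (closed y ∩ᵇ lookup M)))
    where
    e : Edge G
    e = edge x y (Equivalence.from Bool.T-≡ p)
    split : ∀ v → v ∈ˢ (Nᵉ[ G ] e ∩ M) → (closed x ∩ᵇ lookup M) v or (closed y ∩ᵇ lookup M) v ≡ true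
    split v q with a , b ← x∈p∩q⁻ (Nᵉ[ G ] e) M q with x∈p∪q⁻ (N[ G ] x) (N[ G ] y) a
    ... | inj₁ c = true-orˡ (true-and (∈N⇒closed c) ([]=⇒lookup b))
    ... | inj₂ c = true-orʳ {(closed x ∩ᵇ lookup M) v} (true-and (∈N⇒closed c) ([]=⇒lookup b))

  -- Each edge has an end in `C`. Either that end sees three elements of `L`, which settles both
  -- conditions, or its whole neighbourhood and with it both ends of the edge lie in `L`. If the
  -- latter holds for two distinct edges, they have at least three ends between them.
  saturated-liar : ∀ (C L : BSet n) →
    (∀ {x y} → adj G x y ≡ true → x ∈ C ⊎ y ∈ C) →
    (∀ {v} → v ∈ C → closed v ⊆ L ⊎ 3 ≤ count (closed v ∩ᵇ L)) →
    IsLiarVEDominating G (tabulate L)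
  saturated-liar C L cover saturated = twice , thrice
    where
    joined : ∀ e → adj G (src e) (tgt e) ≡ true
    joined e = Equivalence.to Bool.T-≡ (adjacent e)

    at-src : ∀ e {u} → u ∈ closed (src e) → u ∈ˢ Nᵉ[ G ] e
    at-src e u∈ = x∈p∪q⁺ (inj₁ (closed⇒∈N u∈))

    at-tgt : ∀ e {u} → u ∈ closed (tgt e) → u ∈ˢ Nᵉ[ G ] e
    at-tgt e u∈ = x∈p∪q⁺ {p = N[ G ] (src e)} (inj₂ (closed⇒∈N u∈))

    endpoint : ∀ e → (src e ∈ L × tgt e ∈ L) ⊎
               (∃[ z ] 3 ≤ count (closed z ∩ᵇ L) × (∀ {u} → u ∈ closed z → u ∈ˢ Nᵉ[ G ] e))
    endpoint e with cover (joined e)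
    ... | inj₁ x∈C with saturated x∈C
    ...   | inj₁ full = inj₁ (full _ (N-refl _) , full _ (closed-adj (joined e)))
    ...   | inj₂ rich = inj₂ (src e , rich , at-src e)
    endpoint e | inj₂ y∈C with saturated y∈C
    ...   | inj₁ full = inj₁ (full _ (N-sym (closed-adj (joined e))) , full _ (N-refl _))
    ...   | inj₂ rich = inj₂ (tgt e , rich , at-tgt e)

    rich-≤ : ∀ {z} (P : Subset n) → (∀ {u} → u ∈ closed z → u ∈ˢ P) → 3 ≤ count (closed z ∩ᵇ L) →
             3 ≤ ∣ P ∩ tabulate L ∣
    rich-≤ {z} P z⊆P rich = ≤-trans rich (count≤∣∣ (closed z ∩ᵇ L) (P ∩ tabulate L)
      λ v p → x∈p∩q⁺ (z⊆P (proj₁ (and-true p)) , tabulate-∈ (proj₂ (and-true {closed z v} p))))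

    inP : ∀ (P : Subset n) {v} → v ∈ˢ P → v ∈ L → lookup (P ∩ tabulate L) v ≡ true
    inP P v∈P v∈L = []=⇒lookup (x∈p∩q⁺ (v∈P , tabulate-∈ v∈L))

    twice : ∀ e → 2 ≤ ∣ Nᵉ[ G ] e ∩ tabulate L ∣
    twice e with endpoint e
    ... | inj₂ (z , rich , z⊆) = ≤-trans (s≤s (s≤s z≤n)) (rich-≤ (Nᵉ[ G ] e) z⊆ rich)
    ... | inj₁ (x∈L , y∈L) = ≤-trans
      (2≤count (lookup (Nᵉ[ G ] e ∩ tabulate L)) (inP (Nᵉ[ G ] e) (at-src e (N-refl _)) x∈L)
               (inP (Nᵉ[ G ] e) (at-tgt e (N-refl _)) y∈L) (adj-≢ (joined e)))
      (≤-reflexive (sym (count-lookup (Nᵉ[ G ] e ∩ tabulate L))))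

    third : ∀ e f → ¬ SameEdge e f → src f ∈ L → tgt f ∈ L →
            ∃[ w ] w ∈ L × w ∈ˢ Nᵉ[ G ] f × src e ≢ w × tgt e ≢ w
    third e f e≢f x∈L y∈L with src f ≟ᶠ src e | src f ≟ᶠ tgt e
    ... | no p  | no q  = src f , x∈L , at-src f (N-refl _) , p ∘ sym , q ∘ sym
    -- Were `tgt f` also an end of `e`, either `f` would be a loop or the two edges would coincide.
    ... | yes p | _     = tgt f , y∈L , at-tgt f (N-refl _)
                        , (λ r → adj-≢ (joined f) (trans p r)) , (λ r → e≢f (inj₁ (sym p , r)))
    ... | no _  | yes q = tgt f , y∈L , at-tgt f (N-refl _)
                        , (λ r → e≢f (inj₂ (r , sym q))) , (λ r → adj-≢ (joined f) (trans q r))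

    thrice : ∀ e f → ¬ SameEdge e f → 3 ≤ ∣ (Nᵉ[ G ] e ∪ Nᵉ[ G ] f) ∩ tabulate L ∣
    thrice e f e≢f with endpoint e | endpoint f
    ... | inj₂ (z , rich , z⊆) | _ = rich-≤ (Nᵉ[ G ] e ∪ Nᵉ[ G ] f) (λ u∈ → x∈p∪q⁺ (inj₁ (z⊆ u∈))) rich
    ... | inj₁ _ | inj₂ (z , rich , z⊆) =
      rich-≤ (Nᵉ[ G ] e ∪ Nᵉ[ G ] f) (λ u∈ → x∈p∪q⁺ {p = Nᵉ[ G ] e} (inj₂ (z⊆ u∈))) rich
    ... | inj₁ (x∈L , y∈L) | inj₁ (x′∈L , y′∈L) with third e f e≢f x′∈L y′∈L
    ...   | w , w∈L , w∈f , x≢w , y≢w = ≤-trans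
      (3≤count (lookup (P ∩ tabulate L))
               (inP P (x∈p∪q⁺ (inj₁ (at-src e (N-refl _)))) x∈L)
               (inP P (x∈p∪q⁺ (inj₁ (at-tgt e (N-refl _)))) y∈L)
               (inP P (x∈p∪q⁺ {p = Nᵉ[ G ] e} (inj₂ w∈f)) w∈L) (adj-≢ (joined e)) x≢w y≢w)
      (≤-reflexive (sym (count-lookup (P ∩ tabulate L))))
      where
      P : Subset n
      P = Nᵉ[ G ] e ∪ Nᵉ[ G ] f

  module _ (a b c p : ℕ) (free : ClawFree p G) where

    open Weights a b c using (candidates; final)
    open Layers closed candidates (p ∸ 1) N-refl N-sym (star-bound free)
                (λ {v} v∈C → nonisolated-neighbour (proj₂ (and-true {R-of final v} v∈C)))

    -- The empty set is saturated for `k = 0`; each layer raises the level by one.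
    module First  = Layer 0 z≤n ∅ (λ _ → inj₂ z≤n)
    module Second = Layer 1 (s≤s z≤n) (layer 1 candidates ∅) First.saturated₃
    module Third  = Layer 2 ≤-refl (layer 2 candidates (layer 1 candidates ∅)) Second.saturated₃

    output : BSet n
    output = layers candidates

    output-saturated : Saturated 3 output
    output-saturated = Third.saturated₃

    output-size : count output ≡ count First.charged + count Second.charged + count Third.charged
    output-size = trans Third.charged-size (cong (λ m → m + count Third.charged)
      (trans Second.charged-size (cong (λ m → m + count Second.charged)
        (trans First.charged-size (cong (λ m → m + count First.charged) (count-∅ n))))))

    output-small : ∀ {m} → (∀ Q → Q ⊆ candidates → (∀ v → count (closed v ∩ᵇ Q) ≤ p ∸ 1) → count Q ≤ (p ∸ 1) * m) →
                   count output ≤ (3 * (p ∸ 1)) * m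
    output-small {m} bound = begin
      count output                                        ≡⟨ output-size ⟩
      count First.charged + count Second.charged + count Third.charged
        ≤⟨ +-mono-≤ (+-mono-≤ (bound First.charged First.charged-⊆ First.charged-spread)
                              (bound Second.charged Second.charged-⊆ Second.charged-spread))
                    (bound Third.charged Third.charged-⊆ Third.charged-spread) ⟩
      (p ∸ 1) * m + (p ∸ 1) * m + (p ∸ 1) * m             ≡⟨ triple (p ∸ 1) m ⟩
      (3 * (p ∸ 1)) * m                                   ∎
      where
      open ≤-Reasoning
      triple : ∀ q m → q * m + q * m + q * m ≡ (3 * q) * m
      triple = ℕ-Solver.solve-∀

-- Choice of the exponents and the approximation ratio

tiny-nonadjacent : ∀ {n} (G : Graph n) → ¬ (2 ≤ n) → ∀ x y → adj G x y ≢ true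
tiny-nonadjacent {suc zero}    G small zero zero p = true≢false p (no-loop G zero)
tiny-nonadjacent {suc (suc n)} G small x y p       = small (s≤s (s≤s z≤n))

-- The exponents depend on `p` alone, so the program is fixed before the graph. The threshold
-- exponent is `suc (2 + p)`; accordingly `bound-large` and `rounds-enough` are used at `2 + p`.
thresholdExponent boundExponent roundsExponent : ℕ → ℕ
thresholdExponent p = 3 + p
boundExponent p     = 5 + (2 + p)
roundsExponent p    = 2 + ((2 + (2 + p)) + (2 + (2 + p)))

module Solution {n : ℕ} (G : Graph n) (p : ℕ) (free : ClawFree p G) where
  open OnGraph G
  open Run (adj G)

  a b c : ℕ
  a = thresholdExponent p
  b = boundExponent p
  c = roundsExponent p

  open Weights a b c using (candidates; final)

  module Large (2≤n : 2 ≤ n) = Bounds a b c (p ∸ 1) N-refl N-sym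
    (rounds-enough 2≤n (2 + p)) (bound-large 2≤n (2 + p)) (threshold-large 2≤n (m∸n≤m p 1))

  solution : BSet n
  solution = output a b c p free

  candidate-cover : ∀ {x y} → adj G x y ≡ true → x ∈ candidates ⊎ y ∈ candidates
  candidate-cover {x} {y} e with 2 ≤? n
  -- The growth estimates require `2 ≤ n`; a smaller graph has no edges.
  ... | no small = contradiction e (tiny-nonadjacent G small x y)
  ... | yes 2≤n  = Sum.map (λ r → true-and r (adj-nonisolated e))
                           (λ r → true-and r (adj-nonisolated (trans (adj-sym G y x) e)))
                           (Large.final-cover 2≤n e)

  solution-liar : IsLiarVEDominating G (tabulate solution)
  solution-liar = saturated-liar candidates solution candidate-cover (output-saturated a b c p free)

  candidates-empty : ¬ (2 ≤ n) → ∀ v → v ∈ candidates → v ∈ ∅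
  candidates-empty small v v∈C with for-or (adj G v) (proj₂ (and-true {R-of final v} v∈C))
  ... | inj₁ (u , e) = contradiction e (tiny-nonadjacent G small v u)

  charge-bound : ∀ {M} → IsLiarVEDominating G M → ∀ Q → Q ⊆ candidates →
                 (∀ v → count (closed v ∩ᵇ Q) ≤ p ∸ 1) → count Q ≤ (p ∸ 1) * ∣ M ∣
  charge-bound {M} liar Q Q⊆C spread with 2 ≤? n
  ... | yes 2≤n = ≤-trans
    (Large.spread-bound 2≤n (lookup M) (edge-meets liar) Q (λ v v∈ → proj₁ (and-true (Q⊆C v v∈))) spread)
    (≤-reflexive (cong (λ m → (p ∸ 1) * m) (sym (count-lookup M))))
  ... | no small = ≤-trans (count-mono Q ∅ (λ v v∈ → candidates-empty small v (Q⊆C v v∈)))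
                           (≤-trans (≤-reflexive (count-∅ n)) z≤n)

  solution-small : ∀ M → IsLiarVEDominating G M → ∣ tabulate solution ∣ ≤ (3 * (p ∸ 1)) * ∣ M ∣
  solution-small M liar = ≤-trans (∣∣≤count solution (tabulate solution) (λ _ → ∈-tabulate))
                                  (output-small a b c p free (charge-bound liar))

theorem16 : ∀ (p : ℕ) →
    ∃[ A ] ∃[ c ] ∃[ k ]
    ∀ {n : ℕ} (G : Graph n) → ClawFree p G →
    ∃[ L ] ∃[ t ]
    Outputs A (encodeGraph G) (encodeSubset L) t
    × t ≤ c * size (encodeGraph G) ^ k
    × IsLiarVEDominating G L
    × (∀ (M : Subset n) → IsMinimumLiarVEDominating G M →
    ∣ L ∣ ≤ (3 * (p ∸ 1)) * ∣ M ∣)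
theorem16 p = toProgram algorithm , c , k , λ G free →
  let open Run (adj G) using (liarᵗ-spec)
      open Solution G p free using (solution; solution-liar; solution-small)
      t , outputs , t≤ = run G
  in tabulate solution , t
   , subst (λ l → Outputs (toProgram algorithm) (encodeGraph G) (encodeSubset (tabulate l)) t)
           (liarᵗ-spec (thresholdExponent p) (boundExponent p) (roundsExponent p)) outputs
   , t≤ , solution-liar , λ M minimum → solution-small M (proj₁ minimum)
  where
  algorithm : Term (vec (vec bool) ∷ []) (vec bool)
  algorithm = liarᵗ (thresholdExponent p) (boundExponent p) (roundsExponent p)

  c k : ℕ
  c = proj₁ (toProgram-outputs algorithm)
  k = proj₁ (proj₂ (toProgram-outputs algorithm))
  run = proj₂ (proj₂ (toProgram-outputs algorithm))
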